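{- For $n\ge2$ and $j\ge0$ let $s_{j,n}$ be the number of super-strong Wilf equivalence classes of $\mathcal S_n$ having exactly $2^j$ elements (so $s_{0,n}=0$, $s_{1,2}=s_{1,3}=s_{2,3}=1$). Then for every $n\ge4$ and $j\in[n-1]$, $$s_{j,n}=s_{j-1,n-1}+\sum_{k=2}^{n-j-1} d_{k,n}\, s_{j,n-k},$$ where $d_{k,n}=|\mathcal D_{k,n}|$ (an empty sum is $0$).
   Context: $[n]=\{1,\ldots,n\}$; $\mathcal S_n$ is the set of permutations of $[n]$ as words. Super-strong Wilf equivalence: for finite words $u,w$ over $\mathbb P$, $j$ is an embedding index of $u$ in $w$ if $j+|u|-1\le|w|$ and $u_k\le w_{j+k-1}$ for all $k$; $Em(u,w)$ is the set of such $j$; $u\sim_{ss}v$ if there is a bijection $f$ of the set of finite words over $\mathbb P$ preserving length and sum of letters with $Em(u,w)=Em(v,f(w))$ for all $w$. Every super-strong Wilf class of $\mathcal S_n$ has cardinality a power of $2$. A finite set $A\subset\mathbb P$ with $|A|\ge2$ is periodic if the differences of consecutive elements (in increasing order) are all equal. For $n\ge3$, $i\in[n-2]$, $\mathcal D_{i,n}$ is the set of words $u=u_1\cdots u_i$ of $i$ distinct letters of $[n]$ such that $[n]\setminus\{u_1,\ldots,u_i\}$ is periodic and for every $j<i$ the set $[n]\setminus\{u_1,\ldots,u_j\}$ is not periodic. -}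

module Defs where

open import Data.Fin using (Fin; _↑ʳ_; inject≤)
open import Data.Fin.Permutation using (↔⇒≡)
open import Data.List using (List; length; map; filter; lookup; take; sum; upTo; applyUpTo)
open import Data.List.Membership.DecPropositional using (_∉?_)
open import Data.List.Relation.Binary.Permutation.Propositional using (_↭_)
open import Data.List.Relation.Binary.Subset.Propositional using (_⊆_)
open import Data.List.Relation.Unary.Linked using (Linked)
open import Data.List.Relation.Unary.Unique.Propositional using (Unique)
open import Data.Nat using (ℕ; suc; _+_; _∸_; _^_; _≤_; _<_; NonZero)
open import Data.Nat.Properties using (_≟_)
open import Data.Product using (Σ; Σ-syntax; ∃-syntax; _×_; proj₁)
open import Data.Refinement using (Refinement-syntax; value)
open import Function.Base using (_∘_)
open import Function.Bundles using (Inverse; _↔_)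
open import Function.Construct.Composition using (inverse)
open import Function.Construct.Identity using (↔-id)
open import Function.Construct.Symmetry using () renaming (inverse to inverse-sym)
open import Level using (0ℓ)
open import Relation.Binary.Bundles using (Setoid)
import Relation.Binary.Construct.On as On
open import Relation.Binary.PropositionalEquality as ≡ using (_≡_; refl; sym; trans; subst)
open import Relation.Nullary using (¬_)
open import Relation.Unary using (Pred; _≐_)
open import Relation.Unary.Properties using (≐-refl; ≐-sym; ≐-trans)

------------------------------------------------------------------------
-- Words over the positive integers

ℙ : Set
ℙ = [ n ∈ ℕ ∣ NonZero n ]

Word : Set
Word = List ℙ

letters : Word → List ℕ
letters = map value

⟦_⟧ : ℕ → List ℕ
⟦ n ⟧ = map suc (upTo n)

-- 𝒮 n u : the word u is a permutation of [n].
𝒮 : ℕ → Pred Word 0ℓ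
𝒮 n u = letters u ↭ ⟦ n ⟧

------------------------------------------------------------------------
-- Super-strong Wilf equivalence

-- Positions are counted from 0: Em u w i says that i + 1 is an embedding
-- index of u in w in the usual 1-based convention.
Em : Word → Word → Pred ℕ 0ℓ
Em u w i = Σ[ fits ∈ i + length u ≤ length w ]
  (∀ (k : Fin (length u)) →
     value (lookup u k) ≤ value (lookup w (inject≤ (i ↑ʳ k) fits)))

infix 4 _∼ss_

record _∼ss_ (u v : Word) : Set where
  field
    bijection        : Word ↔ Word
  open Inverse bijection public using (to; from; strictlyInverseˡ)
  field
    preserves-length : ∀ w → length (to w) ≡ length w
    preserves-sum    : ∀ w → sum (letters (to w)) ≡ sum (letters w)
    preserves-Em     : ∀ w → Em u w ≐ Em v (to w)

∼ss-refl : ∀ {u} → u ∼ss u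
∼ss-refl = record
  { bijection        = ↔-id Word
  ; preserves-length = λ _ → refl
  ; preserves-sum    = λ _ → refl
  ; preserves-Em     = λ _ → ≐-refl
  }

∼ss-sym : ∀ {u v} → u ∼ss v → v ∼ss u
∼ss-sym {u} {v} p = record
  { bijection        = inverse-sym bijection
  ; preserves-length = λ w → trans (sym (preserves-length (from w)))
                                   (≡.cong length (strictlyInverseˡ w))
  ; preserves-sum    = λ w → trans (sym (preserves-sum (from w)))
                                   (≡.cong (sum ∘ letters) (strictlyInverseˡ w))
  ; preserves-Em     = λ w → ≐-sym
      (subst (λ x → Em u (from w) ≐ Em v x) (strictlyInverseˡ w)
             (preserves-Em (from w)))
  } where open _∼ss_ p

∼ss-trans : ∀ {u v w} → u ∼ss v → v ∼ss w → u ∼ss w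
∼ss-trans p q = record
  { bijection        = inverse P.bijection Q.bijection
  ; preserves-length = λ x → trans (Q.preserves-length (P.to x)) (P.preserves-length x)
  ; preserves-sum    = λ x → trans (Q.preserves-sum (P.to x)) (P.preserves-sum x)
  ; preserves-Em     = λ x → ≐-trans (P.preserves-Em x) (Q.preserves-Em (P.to x))
  } where module P = _∼ss_ p
          module Q = _∼ss_ q

∼ss-setoid : Setoid 0ℓ 0ℓ
∼ss-setoid = record
  { Carrier       = Word
  ; _≈_           = _∼ss_
  ; isEquivalence = record { refl = ∼ss-refl ; sym = ∼ss-sym ; trans = ∼ss-trans }
  }

------------------------------------------------------------------------
-- Cardinality

-- The setoid S has exactly m elements up to its equality.
HasSize : Setoid 0ℓ 0ℓ → ℕ → Set
HasSize S m = Inverse S (≡.setoid (Fin m))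

-- Hence "the" number of elements is unambiguous whenever it exists.
HasSize-unique : ∀ {S m n} → HasSize S m → HasSize S n → m ≡ n
HasSize-unique p q = ↔⇒≡ (inverse (inverse-sym p) q)

-- Words satisfying P, compared as words (the proofs of P are ignored).
⟪_⟫ : Pred Word 0ℓ → Setoid 0ℓ 0ℓ
⟪ P ⟫ = On.setoid {B = Σ Word P} (≡.setoid Word) proj₁

-- The super-strong Wilf class of u in 𝒮ₙ.
class : ℕ → Word → Pred Word 0ℓ
class n u v = 𝒮 n v × u ∼ss v

-- The permutations in 𝒮ₙ lying in a class with 2 ^ j elements, taken up to
-- ∼ss; an element of this setoid is thus a class.
classes : ℕ → ℕ → Setoid 0ℓ 0ℓ
classes j n = On.setoid
  {B = Σ[ u ∈ Word ] 𝒮 n u × HasSize ⟪ class n u ⟫ (2 ^ j)} ∼ss-setoid proj₁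

------------------------------------------------------------------------
-- Periodic sets and 𝒟

-- The complement of xs in [n], listed in increasing order.
⟦_⟧∖_ : ℕ → List ℕ → List ℕ
⟦ n ⟧∖ xs = filter (λ x → _∉?_ _≟_ x xs) ⟦ n ⟧

-- A finite set is given by the increasing list of its elements; Linked
-- relates every pair of consecutive entries.
Periodic : Pred (List ℕ) 0ℓ
Periodic A = 2 ≤ length A × ∃[ p ] Linked (λ x y → y ≡ p + x) A

-- not-periodic concerns nonempty proper prefixes only: [n] itself is always
-- periodic for n ≥ 2.
record 𝒟 (i n : ℕ) (u : Word) : Set where
  field
    length-i     : length u ≡ i
    distinct     : Unique (letters u)
    in-[n]       : letters u ⊆ ⟦ n ⟧
    periodic     : Periodic (⟦ n ⟧∖ letters u)
    not-periodic : ∀ j → 1 ≤ j → j < i → ¬ Periodic (⟦ n ⟧∖ take j (letters u))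

-- f a + f (a + 1) + ⋯ + f b, which is 0 if b < a.
sumFromTo : ℕ → ℕ → (ℕ → ℕ) → ℕ
sumFromTo a b f = sum (applyUpTo (λ i → f (a + i)) (suc b ∸ a))

{-# OPTIONS --safe #-}
-- Write a permutation as the list s₁ s₂ … sₙ of the positions of its letters.
-- Two permutations are super-strongly Wilf equivalent iff, for each h, their
-- sets {sₕ, …, sₙ} are translates of each other.
--
-- For sufficiency it is enough to move a letter h from the left end of a set
-- {a, a + c, …, b} of positions to the right end while the larger letters, which
-- fill the rest of the set, move c to the left; the bijection of words rotates
-- each maximal run, in steps of c, of letters ≥ h.
--
-- For necessity, let E be a finite set of indices.  The least sum of a word of
-- given length that contains u at all places of E is, up to a constant, the sum
-- over h of |A_h + E|, where A_h is the set of positions of the letters above h;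
-- so it is the same for both permutations.  If E is an interval with a reflected
-- copy of B left out, the sum tells the total number of translates of the A_h
-- inside B, and B = A_h gives the claim for A_h by induction on |A_h|.
--
-- Removing two different elements of a finite set leaves translates only if the
-- set is periodic and the elements are its two ends.  Hence a class has a unique
-- member in which the first element of a periodic set is never removed, and its
-- size is 2 to the number of times the last one is.  Deleting elements until the
-- complement becomes periodic for the first time yields the recurrence, since all
-- periodic sets of m elements are affinely equivalent to [m].

module Submission where

open import Defs
open import Data.Nat using (ℕ; _+_; _*_; _∸_; _≤_)
open import Data.Product using (∃₂; _×_)
open import Relation.Binary.PropositionalEquality using (_≡_)

open import Data.Bool as Bool using (Bool; true; false; T)
open import Data.Fin as Fin using (Fin; toℕ)
open import Data.Fin.Properties using (toℕ-inject≤; toℕ-↑ʳ; toℕ<n; toℕ-fromℕ<)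
open import Data.Irrelevant using () renaming ([_] to irr)
open import Data.List
  using (List; []; _∷_; _∷ʳ_; _++_; [_]; length; map; drop; take; lookup; upTo; applyUpTo;
    concatMap; filter; cartesianProductWith)
open import Data.List.Membership.DecPropositional Data.Nat._≟_ using (_∈?_; _∉?_)
open import Data.List.Membership.Propositional using (_∈_; _∉_; find; lose)
open import Data.List.Membership.Propositional.Properties
  using (∈-∃++; ∈-++⁺ˡ; ∈-++⁺ʳ; ∈-++⁻; ∈-map⁺; ∈-map⁻; ∈-concatMap⁺; ∈-concatMap⁻; ∈-upTo⁺;
    ∈-upTo⁻; ∈-cartesianProductWith⁺; ∈-cartesianProductWith⁻; ∈-filter⁺; ∈-filter⁻; ∈-lookup)
open import Data.List.Properties
  using (length-++; ++-identityʳ; ++-assoc; map-++; map-injective; map-cong; map-∘; map-id;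
    length-map; drop-map; length-drop; ∷-injectiveˡ; ∷-injectiveʳ; ∷ʳ-injective; ∷ʳ-injectiveʳ;
    length-upTo; length-applyUpTo; map-upTo; map-applyUpTo; filter-all; filter-accept;
    filter-reject)
open import Data.List.Relation.Binary.Disjoint.Propositional using (Disjoint)
open import Data.List.Relation.Binary.Permutation.Propositional
  using (_↭_; ↭-refl; ↭-sym; ↭-trans; ↭-prep; ↭-reflexive; ↭⇒↭ₛ)
open import Data.List.Relation.Binary.Permutation.Propositional.Properties
  using (shift; drop-∷; ∈-resp-↭; ↭-length; ↭-map-inv; All-resp-↭; ∷↭∷ʳ; ↭-empty-inv;
    ++⁺ˡ) renaming (map⁺ to ↭-map⁺)
open import Data.List.Relation.Binary.Permutation.Setoid.Properties using (Unique-resp-↭)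
open import Data.List.Relation.Binary.Subset.Propositional using (_⊆_)
open import Data.List.Relation.Unary.All as All using (All; []; _∷_)
import Data.List.Relation.Unary.All.Properties as All
open import Data.List.Relation.Unary.AllPairs as AllPairs using (AllPairs; []; _∷_)
import Data.List.Relation.Unary.AllPairs.Properties as AllPairs
open import Data.List.Relation.Unary.Any using (here; there; index)
open import Data.List.Relation.Unary.Any.Properties using (lookup-index)
open import Data.List.Relation.Unary.Linked as Linked using (Linked; []; [-]; _∷_; linked?)
import Data.List.Relation.Unary.Linked.Properties as Linked
open import Data.List.Relation.Unary.Unique.Propositional using (Unique)
import Data.List.Relation.Unary.Unique.Propositional.Properties as Unique
open import Data.Nat using (zero; suc; pred; _^_; _<_; z≤n; s≤s; z<s; _≟_; _≤?_; _<?_; >-nonZero)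
open import Data.Nat.Induction using (<-rec)
open import Data.Nat.ListAction using (sum)
open import Data.Nat.ListAction.Properties using (sum-↭)
open import Data.Nat.Properties hiding (_≟_; _≤?_; _<?_)
open import Data.Nat.Solver using (module +-*-Solver)
open import Data.Product using (∃; _,_; proj₁; proj₂; map₂)
open import Data.Refinement using (value; _,_; value-injective)
open import Data.Sum as Sum using (_⊎_; inj₁; inj₂)
open import Function.Base using (_∘_; id)
open import Function.Bundles using (mk↔ₛ′)
open import Level using (0ℓ)
open import Relation.Binary.Bundles using (Setoid)
open import Relation.Binary.Definitions using (tri<; tri≈; tri>)
open import Relation.Binary.PropositionalEquality
  using (_≢_; refl; sym; trans; cong; cong₂; subst; subst₂; setoid; module ≡-Reasoning)
open import Relation.Nullary using (¬_; Dec; yes; no; does; contradiction)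
open import Relation.Nullary.Decidable using (map′; dec-true)
open import Relation.Unary using (Pred)
open +-*-Solver using (solve; _:+_; _:*_; _:=_; con)

-- A cardinality is an inverse to `Fin`, so deciding equivalence is not enough: each class is listed
-- in full (`ClassList`), the canonical removal orders are listed once (`enum`), and the exponent of
-- the class is a parameter of `enum`. Counting classes by size thus becomes arithmetic with lengths
-- of lists. The reflection works as follows. Let E be a long interval and E′ the same interval
-- without x - B. A point p of A + E is missed by A + E′ exactly when p - A lies in x - B, that is,
-- when the translate of A by x - p lies in B. In the recurrence, the term with n - 1 comes from
-- removing n, the last element of [n]. Removing 1 is not allowed in a canonical order, and for n ≥
-- 4 every other element leaves a set that is not periodic; so the sum begins at k = 2. It ends at n
-- - j - 1 because, for j ≥ 1, permutations of at most j letters have no class of 2^j elements.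

-- Lists without repetitions.

module _ {X : Set} where

  ∈⇒↭ : {x : X} {ys : List X} → x ∈ ys → ∃ λ ys′ → ys ↭ x ∷ ys′
  ∈⇒↭ x∈ with ∈-∃++ x∈
  ... | as , bs , refl = as ++ bs , shift _ as bs

  unique-↭ : {xs ys : List X} → xs ↭ ys → Unique xs → Unique ys
  unique-↭ p = Unique-resp-↭ (setoid X) (↭⇒↭ₛ p)

  head∉tail : {x : X} {xs : List X} → Unique (x ∷ xs) → x ∉ xs
  head∉tail (px ∷ _) x∈ = All.lookup px x∈ refl

  unique-⊆ : {xs ys : List X} → Unique xs → xs ⊆ ys → ∃ λ zs → ys ↭ xs ++ zs
  unique-⊆ {[]} {ys} _ _ = ys , ↭-refl
  unique-⊆ {x ∷ xs} (px ∷ u) xs⊆ with ∈⇒↭ (xs⊆ (here refl))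
  ... | ys′ , p with unique-⊆ {xs} {ys′} u tail⊆
    where
    tail⊆ : xs ⊆ ys′
    tail⊆ z∈ with ∈-resp-↭ p (xs⊆ (there z∈))
    ... | here refl = contradiction refl (All.lookup px z∈)
    ... | there z∈′ = z∈′
  ... | zs , q = zs , ↭-trans p (↭-prep x q)

  unique-⊆⇒length≤ : {xs ys : List X} → Unique xs → xs ⊆ ys → length xs ≤ length ys
  unique-⊆⇒length≤ {xs} u s with unique-⊆ u s
  ... | zs , p = ≤-trans (m≤m+n _ (length zs))
                         (≤-reflexive (sym (trans (↭-length p) (length-++ xs))))

  unique-⊆⇒↭ : {xs ys : List X} → Unique xs → xs ⊆ ys → length ys ≤ length xs → xs ↭ ys
  unique-⊆⇒↭ {xs} u s l with unique-⊆ u s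
  ... | [] , p = ↭-sym (↭-trans p (↭-reflexive (++-identityʳ xs)))
  ... | z ∷ zs , p = contradiction
    (≤-trans (≤-reflexive (sym (trans (↭-length p) (length-++ xs)))) l) (m+1+n≰m (length xs))

  ∷-↭-unique : {x y : X} {xs : List X} → x ∷ xs ↭ y ∷ xs → Unique (x ∷ xs) → x ≡ y
  ∷-↭-unique p u with ∈-resp-↭ p (here refl)
  ... | here e = e
  ... | there x∈ = contradiction x∈ (head∉tail u)

map-↭⁻ : ∀ a {xs ys} → map (a +_) xs ↭ map (a +_) ys → xs ↭ ys
map-↭⁻ a {xs} p with ↭-map-inv (a +_) p
... | zs , e , q with map-injective (+-cancelˡ-≡ a _ _) e
...   | refl = q

Inc : List ℕ → Set
Inc = AllPairs _<_

inc⇒unique : ∀ {xs} → Inc xs → Unique xs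
inc⇒unique = AllPairs.map <⇒≢

inc-↭⇒≡ : ∀ {xs ys} → Inc xs → Inc ys → xs ↭ ys → xs ≡ ys
inc-↭⇒≡ {[]} {[]} _ _ _ = refl
inc-↭⇒≡ {[]} {_ ∷ _} _ _ p = contradiction (↭-length p) λ ()
inc-↭⇒≡ {_ ∷ _} {[]} _ _ p = contradiction (↭-length p) λ ()
inc-↭⇒≡ {x ∷ xs} {y ∷ ys} (px ∷ ix) (py ∷ iy) p = helper x≡y p
  where
  x≡y : x ≡ y
  x≡y with ∈-resp-↭ p (here refl) | ∈-resp-↭ (↭-sym p) (here refl)
  ... | here e | _ = e
  ... | _ | here e = sym e
  ... | there x∈ | there y∈ = contradiction (All.lookup px y∈) (<-asym (All.lookup py x∈))
  helper : x ≡ y → x ∷ xs ↭ y ∷ ys → x ∷ xs ≡ y ∷ ys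
  helper refl q = cong (x ∷_) (inc-↭⇒≡ ix iy (drop-∷ q))

-- Arithmetic progressions and periodic sets.

ap : ℕ → ℕ → ℕ → List ℕ
ap a p zero = []
ap a p (suc m) = a ∷ ap (p + a) p m

length-ap : ∀ a p m → length (ap a p m) ≡ m
length-ap a p zero = refl
length-ap a p (suc m) = cong suc (length-ap (p + a) p m)

map-ap : ∀ a p m → map (p +_) (ap a p m) ≡ ap (p + a) p m
map-ap a p zero = refl
map-ap a p (suc m) = cong (p + a ∷_) (map-ap (p + a) p m)

ap-∷ʳ : ∀ a p m → ap a p (suc m) ≡ ap a p m ∷ʳ (m * p + a)
ap-∷ʳ a p zero = refl
ap-∷ʳ a p (suc m) = cong (a ∷_) (trans (ap-∷ʳ (p + a) p m) (cong (ap (p + a) p m ∷ʳ_) eq))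
  where
  eq : m * p + (p + a) ≡ p + m * p + a
  eq = trans (sym (+-assoc (m * p) p a)) (cong (_+ a) (+-comm (m * p) p))

ap-≥ : ∀ a p m → All (a ≤_) (ap a p m)
ap-≥ a p zero = []
ap-≥ a p (suc m) = ≤-refl ∷ All.map (≤-trans (m≤n+m a p)) (ap-≥ (p + a) p m)

ap-inc : ∀ a p m → 0 < p → Inc (ap a p m)
ap-inc a p zero 0<p = []
ap-inc a p (suc m) 0<p = All.map (<-≤-trans (m<n+m a 0<p)) (ap-≥ (p + a) p m) ∷ ap-inc (p + a) p m 0<p

ap-linked : ∀ a p m → Linked (λ x y → y ≡ p + x) (ap a p m)
ap-linked a p zero = []
ap-linked a p (suc zero) = [-]
ap-linked a p (suc (suc m)) = refl ∷ ap-linked (p + a) p (suc m)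

linked⇒ap : ∀ {p a xs} → Linked (λ x y → y ≡ p + x) (a ∷ xs) → a ∷ xs ≡ ap a p (suc (length xs))
linked⇒ap [-] = refl
linked⇒ap {p} {a} (refl ∷ l) = cong (a ∷_) (linked⇒ap l)

ap-periodic : ∀ a p m → Periodic (ap a p (2 + m))
ap-periodic a p m = s≤s (s≤s z≤n) , p , ap-linked a p (2 + m)

periodic⇒ap : ∀ {A} → Periodic A → Unique A → ∃ λ a → ∃₂ λ p m → 0 < p × A ≡ ap a p (2 + m)
periodic⇒ap {a ∷ b ∷ A} (_ , zero , refl ∷ l) u = contradiction (here refl) (head∉tail u)
periodic⇒ap {a ∷ b ∷ A} (_ , suc p , l) u = a , suc p , length A , z<s , linked⇒ap l
periodic⇒ap {_ ∷ []} (s≤s () , _) u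

-- A period is a natural number, and positive when no element repeats, so a periodic list is already
-- in increasing order. This is why `Periodic (x ∷ B)` can later say that `x` is the first element
-- of a periodic set, and `Periodic (B ∷ʳ x)` that it is the last.
periodic-↭⇒≡ : ∀ {A C} → Periodic C → C ↭ A → Inc A → C ≡ A
periodic-↭⇒≡ per q inc with periodic⇒ap per (unique-↭ (↭-sym q) (inc⇒unique inc))
... | a , p , m , 0<p , refl = inc-↭⇒≡ (ap-inc a p (2 + m) 0<p) inc q

sum-map-+ : ∀ c xs → sum (map (c +_) xs) ≡ length xs * c + sum xs
sum-map-+ c [] = refl
sum-map-+ c (x ∷ xs) = trans (cong (c + x +_) (sum-map-+ c xs))
  (solve 4 (λ c x l s → c :+ x :+ (l :+ s) := c :+ l :+ (x :+ s)) refl c x (length xs * c) (sum xs))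

-- Follow x, c + x, 2c + x, … : each is in y ∷ S, hence in S until it equals y.
translated-remainders : ∀ c x y S → 0 < c → x ∷ map (c +_) S ↭ y ∷ S →
                        S ↭ ap x c (length S) × y ≡ length S * c + x
translated-remainders c x y S 0<c p = go (length S) x S refl p
  where
  go : ∀ m x S → length S ≡ m → x ∷ map (c +_) S ↭ y ∷ S →
       S ↭ ap x c m × y ≡ m * c + x
  go zero x [] refl p with ∈-resp-↭ p (here refl)
  ... | here e = ↭-refl , sym e
  go (suc m) x S@(_ ∷ S₀) e p with ∈-resp-↭ p (here refl)
  -- `S` is not empty, so its sum is smaller than that of its translate by `c`.
  ... | here refl = contradiction (sum-↭ (drop-∷ p)) (>⇒≢ sum<)
    where
    sum< : sum S < sum (map (c +_) S)
    sum< = <-≤-trans (m<n+m (sum S) {length S * c} (<-≤-trans 0<c (m≤m+n c (length S₀ * c))))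
                     (≤-reflexive (sym (sum-map-+ c S)))
  ... | there x∈S with ∈⇒↭ x∈S
  -- Cancelling `x` on both sides leaves the same situation for `S′`, with `c + x` in the role of
  -- `x`.
  ...   | S′ , q with go m (c + x) S′ (suc-injective (trans (sym (↭-length q)) e)) step
    where
    step : c + x ∷ map (c +_) S′ ↭ y ∷ S′
    step = drop-∷ {x = x} (↭-trans (↭-prep x (↭-map⁺ (c +_) (↭-sym q)))
             (↭-trans p (↭-trans (↭-prep y q) (_↭_.swap y x ↭-refl))))
  ...     | r , e′ = ↭-trans q (↭-prep x r) ,
                     trans e′ (trans (sym (+-assoc (m * c) c x)) (cong (_+ x) (+-comm (m * c) c)))

-- Translates of sets and similar removal orders.

-- Both sides are shifted so that a translation to the left needs no subtraction.
Translate : List ℕ → List ℕ → Set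
Translate s t = ∃₂ λ a b → map (a +_) s ↭ map (b +_) t

-- For a list `s` of positions, `drop i s` is the set of positions of the letters above `i`.
Sim : List ℕ → List ℕ → Set
Sim s t = ∀ i → Translate (drop i s) (drop i t)

map-+-+ : ∀ a b s → map (a +_) (map (b +_) s) ≡ map (a + b +_) s
map-+-+ a b s = trans (sym (map-∘ s)) (map-cong (λ x → sym (+-assoc a b x)) s)

↭⇒translate : ∀ {s t} → s ↭ t → Translate s t
↭⇒translate p = 0 , 0 , ↭-map⁺ _ p

translate-sym : ∀ {s t} → Translate s t → Translate t s
translate-sym (a , b , p) = b , a , ↭-sym p

translate-trans : ∀ {r s t} → Translate r s → Translate s t → Translate r t
translate-trans {r} {s} {t} (a , b , p) (a′ , b′ , q) = a′ + a , b + b′ ,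
  ↭-trans (↭-reflexive (sym (map-+-+ a′ a r))) (↭-trans (↭-map⁺ (a′ +_) p)
  (↭-trans (↭-reflexive (trans (map-+-+ a′ b s) (trans (cong (λ z → map (z +_) s) (+-comm a′ b)) (sym (map-+-+ b a′ s)))))
  (↭-trans (↭-map⁺ (b +_) q) (↭-reflexive (map-+-+ b b′ t)))))

translate-map : ∀ c s → Translate s (map (c +_) s)
translate-map c s = c , 0 , ↭-reflexive (sym (map-id (map (c +_) s)))

sim-refl : ∀ {s} → Sim s s
sim-refl i = ↭⇒translate ↭-refl

sim-sym : ∀ {s t} → Sim s t → Sim t s
sim-sym p i = translate-sym (p i)

sim-trans : ∀ {r s t} → Sim r s → Sim s t → Sim r t
sim-trans p q i = translate-trans (p i) (q i)

sim-map : ∀ c s → Sim s (map (c +_) s)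
sim-map c s i = subst (Translate (drop i s)) (sym (drop-map i s)) (translate-map c (drop i s))

sim-∷ : ∀ {x y s t} → x ∷ s ↭ y ∷ t → Sim s t → Sim (x ∷ s) (y ∷ t)
sim-∷ p q zero = ↭⇒translate p
sim-∷ p q (suc i) = q i

sim-tail : ∀ {x y s t} → Sim (x ∷ s) (y ∷ t) → Sim s t
sim-tail p i = p (suc i)

-- Cancelling the smaller shift leaves a translation in a definite direction, the form that the
-- exchange of removals and the elementary move need.
data TranslateView (s t : List ℕ) : Set where
  same : s ↭ t → TranslateView s t
  up   : ∀ c → 0 < c → t ↭ map (c +_) s → TranslateView s t
  down : ∀ c → 0 < c → s ↭ map (c +_) t → TranslateView s t

translate-view : ∀ {s t} → Translate s t → TranslateView s t
translate-view {s} {t} (a , b , p) with <-cmp a b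
... | tri≈ _ refl _ = same (map-↭⁻ a p)
... | tri< a<b _ _ = down (b ∸ a) (m<n⇒0<n∸m a<b) (map-↭⁻ a (↭-trans p (↭-reflexive
        (sym (trans (map-+-+ a (b ∸ a) t) (cong (λ z → map (z +_) t) (m+[n∸m]≡n (<⇒≤ a<b))))))))
... | tri> _ _ b<a = up (a ∸ b) (m<n⇒0<n∸m b<a) (map-↭⁻ b (↭-trans (↭-sym p) (↭-reflexive
        (sym (trans (map-+-+ b (a ∸ b) s) (cong (λ z → map (z +_) s) (m+[n∸m]≡n (<⇒≤ b<a))))))))

-- Removing one element from a list.

picks : List ℕ → List (ℕ × List ℕ)
picks [] = []
picks (a ∷ A) = (a , A) ∷ map (map₂ (a ∷_)) (picks A)

data Pick : List ℕ → ℕ → List ℕ → Set where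
  here  : ∀ {a A} → Pick (a ∷ A) a A
  there : ∀ {a A x B} → Pick A x B → Pick (a ∷ A) x (a ∷ B)

picks⁻ : ∀ A {x B} → (x , B) ∈ picks A → Pick A x B
picks⁻ (a ∷ A) (here refl) = here
picks⁻ (a ∷ A) (there p) with ∈-map⁻ _ p
... | _ , q , refl = there (picks⁻ A q)

picks⁺ : ∀ {A x B} → Pick A x B → (x , B) ∈ picks A
picks⁺ here = here refl
picks⁺ (there p) = there (∈-map⁺ _ (picks⁺ p))

pick-↭ : ∀ {A x B} → Pick A x B → A ↭ x ∷ B
pick-↭ here = ↭-refl
pick-↭ {a ∷ _} {x} (there p) = ↭-trans (↭-prep a (pick-↭ p)) (_↭_.swap a x ↭-refl)

∈⇒pick : ∀ {A x} → x ∈ A → ∃ λ B → Pick A x B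
∈⇒pick (here refl) = _ , here
∈⇒pick (there x∈) with ∈⇒pick x∈
... | _ , p = _ , there p

pick-inc : ∀ {A x B} → Inc A → Pick A x B → Inc B
pick-inc (_ ∷ i) here = i
pick-inc (px ∷ i) (there p) with All-resp-↭ (pick-↭ p) px
... | _ ∷ pB = pB ∷ pick-inc i p

pick-length : ∀ {A x B m} → Pick A x B → length A ≡ suc m → length B ≡ m
pick-length p e = suc-injective (trans (sym (↭-length (pick-↭ p))) e)

pick-functional : ∀ {A x B B′} → Inc A → Pick A x B → Pick A x B′ → B ≡ B′
pick-functional i p q = inc-↭⇒≡ (pick-inc i p) (pick-inc i q)
  (drop-∷ (↭-trans (↭-sym (pick-↭ p)) (pick-↭ q)))

picks-heads : ∀ A → map proj₁ (picks A) ≡ A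
picks-heads [] = refl
picks-heads (a ∷ A) = cong (a ∷_) (trans (sym (map-∘ (picks A))) (picks-heads A))

pick-first : ∀ {A x B} → Inc A → Pick A x B → Periodic (x ∷ B) → A ≡ x ∷ B
pick-first i p per = sym (periodic-↭⇒≡ per (↭-sym (pick-↭ p)) i)

pick-last : ∀ {A x B} → Inc A → Pick A x B → Periodic (B ∷ʳ x) → A ≡ B ∷ʳ x
pick-last {x = x} {B} i p per = sym (periodic-↭⇒≡ per (↭-trans (↭-sym (∷↭∷ʳ x B)) (↭-sym (pick-↭ p))) i)

picks-∷ʳ : ∀ A z → picks (A ∷ʳ z) ≡ map (map₂ (_∷ʳ z)) (picks A) ∷ʳ (z , A)
picks-∷ʳ [] z = refl
picks-∷ʳ (a ∷ A) z = cong ((a , A ∷ʳ z) ∷_) (trans (cong (map _) (picks-∷ʳ A z)) (go (picks A)))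
  where
  go : ∀ ps → map (map₂ (a ∷_)) (map (map₂ (_∷ʳ z)) ps ∷ʳ (z , A)) ≡
              map (map₂ (_∷ʳ z)) (map (map₂ (a ∷_)) ps) ∷ʳ (z , a ∷ A)
  go [] = refl
  go (_ ∷ ps) = cong (_ ∷_) (go ps)

-- The two decompositions of `A` are an instance of `translated-remainders`: `B′` is the progression
-- from `x` with step `c`, `y` is its next term, and `B` is `B′` shifted by `c`. So `x` is the first
-- and `y` the last element.
pick-exchange-down : ∀ {A x B y B′ c} → Inc A → Pick A x B → Pick A y B′ →
  0 < c → B ↭ map (c +_) B′ → x ≡ y ⊎ (Periodic (x ∷ B) × Periodic (B′ ∷ʳ y))
pick-exchange-down {A} {x} {B} {y} {B′} {c} i p q 0<c r
  with translated-remainders c x y B′ 0<c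
         (↭-trans (↭-prep x (↭-sym r)) (↭-trans (↭-sym (pick-↭ p)) (pick-↭ q)))
... | B′↭ap , y≡ = ends (length B′) y≡ (inc-↭⇒≡ (pick-inc i q) (ap-inc x c _ 0<c) B′↭ap)
                     (inc-↭⇒≡ (pick-inc i p) (ap-inc (c + x) c _ 0<c)
                       (↭-trans r (↭-trans (↭-map⁺ _ B′↭ap) (↭-reflexive (map-ap x c _)))))
  where
  ends : ∀ m → y ≡ m * c + x → B′ ≡ ap x c m → B ≡ ap (c + x) c m →
         x ≡ y ⊎ (Periodic (x ∷ B) × Periodic (B′ ∷ʳ y))
  -- `A` has only one element here.
  ends zero refl _ _ = inj₁ refl
  ends (suc m) refl refl refl = inj₂ (ap-periodic x c m ,
    subst Periodic (ap-∷ʳ x c (suc m)) (ap-periodic x c m))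

-- Two different removals leave translates only at the two ends of a periodic set.
pick-exchange : ∀ {A x B y B′} → Inc A → Pick A x B → Pick A y B′ → Translate B B′ →
  x ≡ y ⊎ (Periodic (x ∷ B) × Periodic (B′ ∷ʳ y)) ⊎ (Periodic (B ∷ʳ x) × Periodic (y ∷ B′))
pick-exchange i p q tr with translate-view tr
... | same r = inj₁ (∷-↭-unique (↭-trans (↭-prep _ (↭-sym r)) (↭-trans (↭-sym (pick-↭ p))
                       (pick-↭ q))) (unique-↭ (↭-trans (pick-↭ p) (↭-prep _ r)) (inc⇒unique i)))
... | down c 0<c r = Sum.map₂ inj₁ (pick-exchange-down i p q 0<c r)
... | up c 0<c r with pick-exchange-down i q p 0<c r
...   | inj₁ e = inj₁ (sym e)
...   | inj₂ (f , l) = inj₂ (inj₂ (l , f))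

-- Canonical removal orders.

periodic? : ∀ A → Dec (Periodic A)
periodic? [] = no λ { (() , _) }
periodic? (_ ∷ []) = no λ { (s≤s () , _) }
periodic? (a ∷ b ∷ A) = map′ (λ l → s≤s (s≤s z≤n) , b ∸ a , l) from (linked? (λ x y → y ≟ (b ∸ a) + x) _)
  where
  from : Periodic (a ∷ b ∷ A) → Linked (λ x y → y ≡ (b ∸ a) + x) (a ∷ b ∷ A)
  from (_ , p , l@(refl ∷ _)) = subst (λ q → Linked (λ x y → y ≡ q + x) (a ∷ b ∷ A)) (sym (m+n∸n≡m p a)) l

-- The first decision asks whether the removed element is the first of a periodic set, the second
-- whether it is the last. A set of one element is not `Periodic`, so its removal is neither
-- forbidden nor counted.
choose : {P Q : Set} → Dec P → Dec Q → (ℕ → List (List ℕ)) → ℕ → List (List ℕ)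
choose (yes _) _       e j       = []
choose (no _)  (yes _) e zero    = []
choose (no _)  (yes _) e (suc j) = e j
choose (no _)  (no _)  e j       = e j

-- The removal orders of A that never remove the first element of a periodic
-- set and remove exactly j times the last element of one; m is the length of A.
enum : ℕ → ℕ → List ℕ → List (List ℕ)
extend : ℕ → ℕ → ℕ × List ℕ → List (List ℕ)

enum zero    zero    A = [] ∷ []
enum zero    (suc j) A = []
enum (suc m) j       A = concatMap (extend m j) (picks A)

extend m j (x , B) = map (x ∷_) (choose (periodic? (x ∷ B)) (periodic? (B ∷ʳ x)) (λ i → enum m i B) j)

-- The relational form of `choose`: the first index is the exponent of the rest of the order, the
-- second that of the whole order.
data Flips (Q : Set) : ℕ → ℕ → Set where
  flip : ∀ {j} → Q → Flips Q j (suc j)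
  keep : ∀ {j} → ¬ Q → Flips Q j j

choose⁻ : ∀ {P Q} (P? : Dec P) (Q? : Dec Q) e {j t} → t ∈ choose P? Q? e j →
          ¬ P × ∃ λ i → Flips Q i j × t ∈ e i
choose⁻ (no ¬p) (yes q) e {suc j} t∈ = ¬p , j , flip q , t∈
choose⁻ (no ¬p) (no ¬q) e {j} t∈ = ¬p , j , keep ¬q , t∈

choose⁺ : ∀ {P Q} (P? : Dec P) (Q? : Dec Q) e {i j t} → ¬ P → Flips Q i j → t ∈ e i →
          t ∈ choose P? Q? e j
choose⁺ (yes p) _ e ¬p _ _ = contradiction p ¬p
choose⁺ (no _) (yes _) e _ (flip _) t∈ = t∈
choose⁺ (no _) (yes q) e _ (keep ¬q) t∈ = contradiction q ¬q
choose⁺ (no _) (no ¬q) e _ (flip q) t∈ = contradiction q ¬q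
choose⁺ (no _) (no _) e _ (keep _) t∈ = t∈

data Step (m j : ℕ) (A : List ℕ) : List ℕ → Set where
  step : ∀ {x B i t} → Pick A x B → ¬ Periodic (x ∷ B) → Flips (Periodic (B ∷ʳ x)) i j →
         t ∈ enum m i B → Step m j A (x ∷ t)

enum⁻ : ∀ m j A {t} → t ∈ enum (suc m) j A → Step m j A t
enum⁻ m j A t∈ with find (∈-concatMap⁻ (extend m j) {xs = picks A} t∈)
... | (x , B) , p , t∈′ with ∈-map⁻ _ t∈′
...   | t , t∈″ , refl with choose⁻ (periodic? (x ∷ B)) (periodic? (B ∷ʳ x)) _ t∈″
...     | ¬f , i , fl , t∈‴ = step (picks⁻ A p) ¬f fl t∈‴

enum⁺ : ∀ m {j A t} → Step m j A t → t ∈ enum (suc m) j A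
enum⁺ m {j} {A} (step {x} {B} p ¬f fl t∈) = ∈-concatMap⁺ (extend m j) {xs = picks A}
  (lose (picks⁺ p) (∈-map⁺ _ (choose⁺ (periodic? (x ∷ B)) (periodic? (B ∷ʳ x)) _ ¬f fl t∈)))

length-0 : ∀ {A : List ℕ} → length A ≡ 0 → A ≡ []
length-0 {[]} _ = refl

enum-↭ : ∀ m j {A t} → length A ≡ m → t ∈ enum m j A → t ↭ A
enum-↭ zero zero e (here refl) = ↭-reflexive (sym (length-0 e))
enum-↭ (suc m) j {A} e t∈ with enum⁻ m j A t∈
... | step {i = i} p _ _ t∈′ = ↭-trans (↭-prep _ (enum-↭ m i (pick-length p e) t∈′)) (↭-sym (pick-↭ p))

flips-functional : ∀ {Q i j k} → Flips Q i j → Flips Q i k → j ≡ k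
flips-functional (flip _) (flip _) = refl
flips-functional (flip q) (keep ¬q) = contradiction q ¬q
flips-functional (keep ¬q) (flip q) = contradiction q ¬q
flips-functional (keep _) (keep _) = refl

-- By `pick-exchange`, if two similar orders began differently, one of them would begin with the
-- first element of a periodic set, which neither does. A common beginning leaves the same set and
-- raises both exponents or neither.
enum-sim : ∀ m j k {A t r} → Inc A → length A ≡ m → t ∈ enum m j A → r ∈ enum m k A →
           Sim t r → t ≡ r × j ≡ k
enum-sim zero zero zero i e (here refl) (here refl) _ = refl , refl
enum-sim (suc m) j k {A} i e t∈ r∈ s with enum⁻ m j A t∈ | enum⁻ m k A r∈
... | step {i = j₁} p ¬f fl t∈′ | step {i = k₁} q ¬g gl r∈′ with pick-exchange i p q
      (translate-trans (↭⇒translate (↭-sym (enum-↭ m j₁ (pick-length p e) t∈′)))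
        (translate-trans (s 1) (↭⇒translate (enum-↭ m k₁ (pick-length q e) r∈′))))
...   | inj₂ (inj₁ (f , _)) = contradiction f ¬f
...   | inj₂ (inj₂ (_ , g)) = contradiction g ¬g
...   | inj₁ refl with pick-functional i p q
...     | refl with enum-sim m j₁ k₁ (pick-inc i p) (pick-length p e) t∈′ r∈′ (sim-tail s)
...       | refl , refl = refl , flips-functional fl gl

choose-unique : ∀ {P Q} (P? : Dec P) (Q? : Dec Q) e j → (∀ i → Unique (e i)) → Unique (choose P? Q? e j)
choose-unique (yes _) _       e j       u = []
choose-unique (no _)  (yes _) e zero    u = []
choose-unique (no _)  (yes _) e (suc j) u = u j
choose-unique (no _)  (no _)  e j       u = u j

unique-concatMap-picks : (f : ℕ × List ℕ → List (List ℕ)) (A : List ℕ) → Unique A →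
  (∀ {x B} → Pick A x B → Unique (f (x , B))) →
  (∀ {x B t} → t ∈ f (x , B) → ∃ λ t′ → t ≡ x ∷ t′) →
  Unique (concatMap f (picks A))
unique-concatMap-picks f A u each heads = Unique.concat⁺
  (All.map⁺ (All.tabulate λ p → each (picks⁻ A p)))
  (AllPairs.map⁺ (AllPairs.map disjoint (AllPairs.map⁻ (subst Unique (sym (picks-heads A)) u))))
  where
  disjoint : ∀ {p q} → proj₁ p ≢ proj₁ q → Disjoint (f p) (f q)
  disjoint ne (t∈p , t∈q) with heads t∈p | heads t∈q
  ... | _ , refl | _ , e = ne (∷-injectiveˡ e)

enum-unique : ∀ m j {A} → Inc A → Unique (enum m j A)
enum-unique zero zero i = [] ∷ []
enum-unique zero (suc j) i = []
enum-unique (suc m) j {A} i = unique-concatMap-picks (extend m j) A (inc⇒unique i)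
  (λ {x} {B} p → Unique.map⁺ ∷-injectiveʳ
     (choose-unique (periodic? (x ∷ B)) (periodic? (B ∷ʳ x)) _ j λ k → enum-unique m k (pick-inc i p)))
  (λ t∈ → let (t′ , _ , e) = ∈-map⁻ _ t∈ in t′ , e)

-- Listing a class together with its canonical member.

pick-∷ʳ : ∀ B z → Pick (B ∷ʳ z) z B
pick-∷ʳ [] z = here
pick-∷ʳ (b ∷ B) z = there (pick-∷ʳ B z)

pick-translate : ∀ {A x B y B′ s t} → Pick A x B → Pick A y B′ → x ∷ s ↭ A → y ∷ t ↭ A →
                 Translate s t → Translate B B′
pick-translate p q u v tr = translate-trans (↭⇒translate (↭-sym (drop-∷ (↭-trans u (pick-↭ p)))))
  (translate-trans tr (↭⇒translate (drop-∷ (↭-trans v (pick-↭ q)))))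

-- Here `s` is any order of `A`. The same exponent indexes `enum` and gives the size, which links
-- the list of canonical orders to the sizes of the classes.
record ClassList (m : ℕ) (A s : List ℕ) : Set where
  field
    exponent       : ℕ
    representative : List ℕ
    members        : List (List ℕ)
    canonical      : representative ∈ enum m exponent A
    similar        : Sim s representative
    unique         : Unique members
    size           : length members ≡ 2 ^ exponent
    sound          : ∀ {r} → r ∈ members → r ↭ A × Sim s r
    complete       : ∀ {r} → r ↭ A → Sim s r → r ∈ members

-- Removing the last element of a progression leaves `ap a c (suc m)`, removing the first leaves its
-- translate by `c`. So every member for the rest serves twice, unchanged after `z` and shifted by
-- `c` after `a`, and the class doubles. The list `s₀` stands for `s`, shifted back into
-- `ap a c (suc m)` if `x` is the first element.
class-list-ends : ∀ a c m {n x s s₀} → length (ap a c (suc m)) ≡ n → 0 < c → x ≡ a ⊎ x ≡ suc m * c + a → x ∷ s ↭ ap a c (2 + m) →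
  Sim s s₀ → ClassList n (ap a c (suc m)) s₀ → ClassList (suc n) (ap a c (2 + m)) (x ∷ s)
class-list-ends a c m {n} {x} {s} {s₀} len 0<c end p sim L = record
  { exponent       = suc exponent
  ; representative = z ∷ representative
  ; members        = map (z ∷_) members ++ map (a ∷_) (map (map (c +_)) members)
  -- Of the two ends, a canonical order removes the last, which raises the exponent.
  ; canonical      = enum⁺ n (step pick-z ¬first (flip (subst Periodic A≡ (ap-periodic a c m))) canonical)
  ; similar        = sim-∷ (↭-trans p (↭-trans A↭z (↭-prep z (↭-sym (enum-↭ n exponent len canonical)))))
                           (sim-trans sim similar)
  ; unique         = Unique.++⁺ (Unique.map⁺ ∷-injectiveʳ unique)
                       (Unique.map⁺ ∷-injectiveʳ (Unique.map⁺ (map-injective (+-cancelˡ-≡ c _ _)) unique)) disjoint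
  ; size           = trans (length-++ (map (z ∷_) members)) (cong₂ _+_ (trans (length-map _ members) size)
                       (trans (length-map _ (map _ members)) (trans (length-map _ members) (trans size (sym (+-identityʳ _))))))
  ; sound          = λ r∈ → sound′ (∈-++⁻ (map (z ∷_) members) r∈)
  ; complete       = complete′
  }
  where
  open ClassList L
  z = suc m * c + a
  A = ap a c (2 + m)
  B = ap a c (suc m)
  A≡ : A ≡ B ∷ʳ z
  A≡ = ap-∷ʳ a c (suc m)
  pick-z : Pick A z B
  pick-z = subst (λ C → Pick C z B) (sym A≡) (pick-∷ʳ B z)
  A↭z : A ↭ z ∷ B
  A↭z = pick-↭ pick-z
  A≡a : A ≡ a ∷ map (c +_) B
  A≡a = cong (a ∷_) (sym (map-ap a c (suc m)))
  inc : Inc A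
  inc = ap-inc a c (2 + m) 0<c
  a≢z : a ≢ z
  a≢z = <⇒≢ (m<n+m a (<-≤-trans 0<c (m≤m+n c (m * c))))
  ¬first : ¬ Periodic (z ∷ B)
  ¬first per = a≢z (∷-injectiveˡ (pick-first inc pick-z per))
  disjoint : Disjoint (map (z ∷_) members) (map (a ∷_) (map (map (c +_)) members))
  disjoint (u , v) with ∈-map⁻ _ u | ∈-map⁻ _ v
  ... | _ , _ , refl | _ , _ , e = a≢z (sym (∷-injectiveˡ e))
  sound′ : ∀ {r} → r ∈ map (z ∷_) members ⊎ r ∈ map (a ∷_) (map (map (c +_)) members) →
           r ↭ A × Sim (x ∷ s) r
  sound′ (inj₁ r∈) with ∈-map⁻ _ r∈
  ... | r₀ , r₀∈ , refl with sound r₀∈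
  ...   | q , sim₀ = q′ , sim-∷ (↭-trans p (↭-sym q′)) (sim-trans sim sim₀)
    where q′ = ↭-trans (↭-prep z q) (↭-sym A↭z)
  sound′ (inj₂ r∈) with ∈-map⁻ _ r∈
  ... | _ , r₁∈ , refl with ∈-map⁻ _ r₁∈
  ...   | r₀ , r₀∈ , refl with sound r₀∈
  ...     | q , sim₀ = q′ , sim-∷ (↭-trans p (↭-sym q′)) (sim-trans sim (sim-trans sim₀ (sim-map c r₀)))
    where q′ = ↭-trans (↭-prep a (↭-map⁺ _ q)) (↭-reflexive (sym A≡a))
  complete′ : ∀ {r} → r ↭ A → Sim (x ∷ s) r → r ∈ map (z ∷_) members ++ map (a ∷_) (map (map (c +_)) members)
  complete′ {[]} q sim′ = contradiction (↭-length q) λ ()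
  complete′ {y ∷ r} q sim′ with y ≟ z | y ≟ a
  ... | yes refl | _ = ∈-++⁺ˡ (∈-map⁺ _ (complete (drop-∷ (↭-trans q A↭z)) (sim-trans (sim-sym sim) (sim-tail sim′))))
  ... | no _ | yes refl with ↭-map-inv (c +_) (↭-sym (drop-∷ (↭-trans q (↭-reflexive A≡a))))
  ...   | r₀ , refl , q₀ = ∈-++⁺ʳ _ (∈-map⁺ _ (∈-map⁺ _ (complete (↭-sym q₀)
            (sim-trans (sim-sym sim) (sim-trans (sim-tail sim′) (sim-sym (sim-map c r₀)))))))
  -- `x` is an end of the progression and `y` is not, but each outcome of `pick-exchange` would make
  -- `y` an end.
  complete′ {y ∷ r} q sim′ | no y≢z | no y≢a with ∈⇒pick (∈-resp-↭ p (here refl)) | ∈⇒pick (∈-resp-↭ q (here refl))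
  ... | _ , px | _ , py with pick-exchange inc px py (pick-translate px py p q (sim′ 1))
  ...   | inj₁ refl = contradiction end λ { (inj₁ e) → y≢a e ; (inj₂ e) → y≢z e }
  ...   | inj₂ (inj₁ (_ , l)) = contradiction (∷ʳ-injectiveʳ B _ (trans (sym A≡) (pick-last inc py l))) (y≢z ∘ sym)
  ...   | inj₂ (inj₂ (_ , f)) = contradiction (∷-injectiveˡ (pick-first inc py f)) (y≢a ∘ sym)

-- As `x` is not an end of a periodic set, `pick-exchange` makes every similar order begin with `x`,
-- so the class is as large as that of the rest.
class-list-∷ : ∀ {m A x B s} → Inc A → length A ≡ suc m → Pick A x B → s ↭ B →
  ¬ Periodic (x ∷ B) → ¬ Periodic (B ∷ʳ x) → ClassList m B s → ClassList (suc m) A (x ∷ s)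
class-list-∷ {m} {A} {x} {B} {s} inc e p s↭ ¬f ¬l L = record
  { exponent       = exponent
  ; representative = x ∷ representative
  ; members        = map (x ∷_) members
  ; canonical      = enum⁺ m (step p ¬f (keep ¬l) canonical)
  ; similar        = sim-∷ (↭-prep x (↭-trans s↭ (↭-sym (enum-↭ m exponent (pick-length p e) canonical)))) similar
  ; unique         = Unique.map⁺ ∷-injectiveʳ unique
  ; size           = trans (length-map _ members) size
  ; sound          = sound′
  ; complete       = complete′
  }
  where
  open ClassList L
  sound′ : ∀ {r} → r ∈ map (x ∷_) members → r ↭ A × Sim (x ∷ s) r
  sound′ r∈ with ∈-map⁻ _ r∈
  ... | r₀ , r₀∈ , refl with sound r₀∈
  ...   | q , sim = ↭-trans (↭-prep x q) (↭-sym (pick-↭ p)) , sim-∷ (↭-prep x (↭-trans s↭ (↭-sym q))) sim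
  complete′ : ∀ {r} → r ↭ A → Sim (x ∷ s) r → r ∈ map (x ∷_) members
  complete′ {[]} q sim = contradiction (trans (↭-length q) e) λ ()
  complete′ {y ∷ r} q sim with ∈⇒pick (∈-resp-↭ q (here refl))
  ... | _ , py with pick-exchange inc p py
                      (pick-translate p py (↭-trans (↭-prep x s↭) (↭-sym (pick-↭ p))) q (sim 1))
  ...   | inj₁ refl = ∈-map⁺ _ (complete (drop-∷ (↭-trans q (pick-↭ p))) (sim-tail sim))
  ...   | inj₂ (inj₁ (f , _)) = contradiction f ¬f
  ...   | inj₂ (inj₂ (l , _)) = contradiction l ¬l

class-list : ∀ m {A s} → Inc A → length A ≡ m → s ↭ A → ClassList m A s
class-list zero {[]} {s} inc e p = record
  { exponent = 0 ; representative = [] ; members = [] ∷ [] ; canonical = here refl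
  ; similar = subst (λ r → Sim r []) (sym (↭-empty-inv p)) sim-refl
  ; unique = [] ∷ [] ; size = refl
  ; sound = λ { (here refl) → ↭-refl , subst (λ r → Sim r []) (sym (↭-empty-inv p)) sim-refl }
  ; complete = λ q _ → here (↭-empty-inv q) }
class-list (suc m) {s = []} inc e p = contradiction (trans (↭-length p) e) λ ()
class-list (suc m) {A} {x ∷ s} inc e p with ∈⇒pick (∈-resp-↭ p (here refl))
... | B , px with drop-∷ (↭-trans p (pick-↭ px)) | periodic? (x ∷ B) | periodic? (B ∷ʳ x)
...   | s↭B | no ¬f | no ¬l = class-list-∷ inc e px s↭B ¬f ¬l
                                 (class-list m (pick-inc inc px) (pick-length px e) s↭B)
class-list (suc m) {A} {x ∷ s} inc e p | B , px | s↭B | no _ | yes l with pick-last inc px l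
... | refl with periodic⇒ap l (inc⇒unique inc)
...   | a , c , k , 0<c , eq with ∷ʳ-injective B (ap a c (suc k)) (trans eq (ap-∷ʳ a c (suc k)))
...     | refl , refl = subst (λ C → ClassList (suc m) C (x ∷ s)) (sym eq)
          (class-list-ends a c k (pick-length px e) 0<c (inj₂ refl) (↭-trans p (↭-reflexive eq)) sim-refl
            (class-list m (ap-inc a c (suc k) 0<c) (pick-length px e) s↭B))
class-list (suc m) {A} {x ∷ s} inc e p | B , px | s↭B | yes f | _ with pick-first inc px f
... | refl with periodic⇒ap f (inc⇒unique inc)
-- When `x` is the first element, the recursion takes place on the progression without its last
-- element, so the rest is shifted down by `c`.
...   | a , c , k , 0<c , refl with ↭-map-inv (c +_) (↭-trans (↭-reflexive (map-ap a c (suc k))) (↭-sym s↭B))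
...     | s₀ , refl , q = class-list-ends a c k len 0<c (inj₁ refl) p (sim-sym (sim-map c s₀))
            (class-list m (ap-inc a c (suc k) 0<c) len (↭-sym q))
  where
  len : length (ap a c (suc k)) ≡ m
  len = trans (length-ap a c (suc k)) (trans (sym (length-ap (c + a) c (suc k))) (suc-injective e))

-- Lists as functions of the position.

nth : {X : Set} → X → List X → ℕ → X
nth d [] k = d
nth d (x ∷ xs) zero = x
nth d (x ∷ xs) (suc k) = nth d xs k

at : List ℕ → ℕ → ℕ
at = nth 0

module _ {X : Set} where

  nth-≥ : ∀ {d : X} xs {k} → length xs ≤ k → nth d xs k ≡ d
  nth-≥ [] _ = refl
  nth-≥ (x ∷ xs) (s≤s l) = nth-≥ xs l

  nth-map : {Y : Set} (f : X → Y) {d : X} {e : Y} (xs : List X) {k : ℕ} → k < length xs →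
            nth e (map f xs) k ≡ f (nth d xs k)
  nth-map f (x ∷ xs) {zero} _ = refl
  nth-map f (x ∷ xs) {suc k} (s≤s l) = nth-map f xs l

  nth-applyUpTo : (f : ℕ → X) {d : X} (n : ℕ) {k : ℕ} → k < n → nth d (applyUpTo f n) k ≡ f k
  nth-applyUpTo f (suc n) {zero} _ = refl
  nth-applyUpTo f (suc n) {suc k} (s≤s l) = nth-applyUpTo (f ∘ suc) n l

  nth-ext : {d : X} {xs ys : List X} → length xs ≡ length ys →
            (∀ {k} → k < length xs → nth d xs k ≡ nth d ys k) → xs ≡ ys
  nth-ext {xs = []} {[]} _ _ = refl
  nth-ext {xs = x ∷ xs} {y ∷ ys} e p = cong₂ _∷_ (p z<s) (nth-ext (suc-injective e) λ l → p (s≤s l))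

  nth-lookup : (d : X) (xs : List X) (i : Fin (length xs)) → nth d xs (toℕ i) ≡ lookup xs i
  nth-lookup d (x ∷ xs) Fin.zero = refl
  nth-lookup d (x ∷ xs) (Fin.suc i) = nth-lookup d xs i

  nth-∈ : {d : X} (xs : List X) {k : ℕ} → k < length xs → nth d xs k ∈ xs
  nth-∈ (x ∷ xs) {zero} _ = here refl
  nth-∈ (x ∷ xs) {suc k} (s≤s l) = there (nth-∈ xs l)

-- Cyclic rotation of the maximal runs, in steps of c, of the entries true of bs.
module Rotation (c : ℕ) (0<c : 0 < c) (bs : List Bool) where

  P : ℕ → Set
  P p = nth false bs p ≡ true

  P? : ∀ p → Dec (P p)
  P? p = nth false bs p Bool.≟ true

  P-< : ∀ {p} → P p → p < length bs
  P-< {p} Pp with length bs ≤? p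
  ... | yes l = contradiction (trans (sym Pp) (nth-≥ bs l)) λ ()
  ... | no l = ≰⇒> l

  Prev : ℕ → Set
  Prev p = ∃ λ q → p ≡ q + c × P q

  Run : ℕ → ℕ → Set
  Run q r = ∃ λ k → r ≡ k * c + q × (∀ i → i ≤ k → P (i * c + q))

  -- Read `p ↦ r` as: the new letter at `p` is the old letter at `r`. So the letters of a run move
  -- `c` places to the left, and the one at its start passes to its end. As a relation, the rotation
  -- is inverted by reading it backwards.
  data _↦_ : ℕ → ℕ → Set where
    out  : ∀ {p} → ¬ P p → p ↦ p
    next : ∀ {p} → P p → P (p + c) → p ↦ (p + c)
    wrap : ∀ {p q} → Run q p → ¬ Prev q → ¬ P (p + c) → p ↦ q

  run-start : ∀ {q r} → Run q r → P q
  run-start (k , _ , f) = f 0 z≤n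

  run-end : ∀ {q r} → Run q r → P r
  run-end (k , refl , f) = f k ≤-refl

  suc-* : ∀ k q → suc k * c + q ≡ k * c + q + c
  suc-* k q = trans (cong (_+ q) (+-comm c (k * c))) (trans (+-assoc (k * c) c q)
    (trans (cong (k * c +_) (+-comm c q)) (sym (+-assoc (k * c) q c))))

  run-end-functional : ∀ {q r r′} → Run q r → Run q r′ → ¬ P (r + c) → ¬ P (r′ + c) → r ≡ r′
  run-end-functional {q} (k , refl , f) (k′ , refl , f′) ¬n ¬n′ with <-cmp k k′
  ... | tri≈ _ refl _ = refl
  ... | tri< l _ _ = contradiction (subst P (suc-* k q) (f′ (suc k) l)) ¬n
  ... | tri> _ _ l = contradiction (subst P (suc-* k′ q) (f (suc k′) l)) ¬n′

  -- Both runs end at the same place and the one from `q′` is longer, so it passes through the place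
  -- one step before `q`.
  prev-of-start : ∀ {k k′ q q′} → k < k′ → k * c + q ≡ k′ * c + q′ → (∀ i → i ≤ k′ → P (i * c + q′)) → Prev q
  prev-of-start {k} {k′} {q} {q′} l eq f = j * c + q′ , q≡ , f j (m∸n≤m k′ (suc k))
    where
    j = k′ ∸ suc k
    k′≡ : k′ ≡ k + suc j
    k′≡ = sym (trans (+-suc k j) (m+[n∸m]≡n l))
    q≡ : q ≡ j * c + q′ + c
    q≡ = trans (+-cancelˡ-≡ (k * c) q (suc j * c + q′) (trans eq (trans
      (cong (λ z → z * c + q′) k′≡) (trans (cong (_+ q′) (*-distribʳ-+ c k (suc j))) (+-assoc (k * c) _ q′))))) (suc-* j q′)

  run-start-functional : ∀ {q q′ r} → Run q r → Run q′ r → ¬ Prev q → ¬ Prev q′ → q ≡ q′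
  run-start-functional {q} {q′} (k , e , f) (k′ , e′ , f′) ¬p ¬p′ with <-cmp k k′
  ... | tri≈ _ refl _ = +-cancelˡ-≡ (k * c) q q′ (trans (sym e) e′)
  ... | tri< l _ _ = contradiction (prev-of-start l (trans (sym e) e′) f′) ¬p
  ... | tri> _ _ l = contradiction (prev-of-start l (trans (sym e′) e) f) ¬p′

  ↦-functional : ∀ {p r r′} → p ↦ r → p ↦ r′ → r ≡ r′
  ↦-functional (out _) (out _) = refl
  ↦-functional (out ¬p) (next p _) = contradiction p ¬p
  ↦-functional (out ¬p) (wrap r _ _) = contradiction (run-end r) ¬p
  ↦-functional (next p _) (out ¬p) = contradiction p ¬p
  ↦-functional (next _ _) (next _ _) = refl
  ↦-functional (next _ n) (wrap _ _ ¬n) = contradiction n ¬n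
  ↦-functional (wrap r _ _) (out ¬p) = contradiction (run-end r) ¬p
  ↦-functional (wrap _ _ ¬n) (next _ n) = contradiction n ¬n
  ↦-functional (wrap r ¬p _) (wrap r′ ¬p′ _) = run-start-functional r r′ ¬p ¬p′

  ↦-injective′ : ∀ {p p′ r r′} → p ↦ r → p′ ↦ r′ → r ≡ r′ → p ≡ p′
  ↦-injective′ (out _) (out _) e = e
  ↦-injective′ (out ¬p) (next _ n) refl = contradiction n ¬p
  ↦-injective′ (out ¬p) (wrap r _ _) refl = contradiction (run-start r) ¬p
  ↦-injective′ (next _ n) (out ¬p) refl = contradiction n ¬p
  ↦-injective′ (next _ _) (next _ _) e = +-cancelʳ-≡ c _ _ e
  ↦-injective′ (next p _) (wrap _ ¬p _) refl = contradiction (_ , refl , p) ¬p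
  ↦-injective′ (wrap r _ _) (out ¬p) refl = contradiction (run-start r) ¬p
  ↦-injective′ (wrap _ ¬p _) (next p _) refl = contradiction (_ , refl , p) ¬p
  ↦-injective′ (wrap r _ ¬n) (wrap r′ _ ¬n′) refl = run-end-functional r r′ ¬n ¬n′

  prev? : ∀ p → Dec (Prev p)
  prev? p with c ≤? p | P? (p ∸ c)
  ... | no ¬l | _ = no λ { (q , refl , _) → ¬l (m≤n+m c q) }
  ... | yes l | yes Pq = yes (p ∸ c , sym (m∸n+n≡m l) , Pq)
  ... | yes l | no ¬P = no λ { (q , refl , Pq) → ¬P (subst P (sym (m+n∸n≡m q c)) Pq) }

  start : ∀ p → P p → ∃ λ q → Run q p × ¬ Prev q
  start = <-rec _ λ p rec Pp → step-back p rec Pp (prev? p)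
    where
    step-back : ∀ p → (∀ {q} → q < p → P q → ∃ λ r → Run r q × ¬ Prev r) → P p →
                Dec (Prev p) → ∃ λ r → Run r p × ¬ Prev r
    step-back p rec Pp (no ¬prev) = p , (0 , refl , λ { zero _ → Pp }) , ¬prev
    step-back p rec Pp (yes (q , refl , Pq)) with rec (m<m+n q 0<c) Pq
    ... | r , (k , e , f) , ¬prev = r , (suc k , sym (trans (suc-* k r) (cong (_+ c) (sym e))) , g) , ¬prev
      where
      g : ∀ i → i ≤ suc k → P (i * c + r)
      g i i≤ with m≤n⇒m<n∨m≡n i≤
      ... | inj₁ (s≤s l) = f i l
      ... | inj₂ refl = subst P (sym (trans (suc-* k r) (cong (_+ c) (sym e)))) Pp

  end : ∀ p → P p → ∃ λ r → Run p r × ¬ P (r + c)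
  -- Each step moves at least one place to the right, and no entry is true from `length bs` on, so
  -- this much fuel suffices.
  end p Pp = go (length bs) p (m≤n+m _ p) Pp
    where
    go : ∀ fuel p → length bs ≤ p + fuel → P p → ∃ λ r → Run p r × ¬ P (r + c)
    go fuel p l Pp with P? (p + c)
    go fuel p l Pp | no ¬n = p , (0 , refl , λ { zero _ → Pp }) , ¬n
    go zero p l Pp | yes Pn = contradiction (≤-trans l (≤-reflexive (+-identityʳ p))) (<⇒≱ (P-< Pp))
    go (suc fuel) p l Pp | yes Pn with go fuel (p + c) (≤-trans l (≤-trans
           (≤-reflexive (trans (+-suc p fuel) (cong (_+ fuel) (+-comm 1 p))))
           (+-monoˡ-≤ fuel (+-monoʳ-≤ p 0<c)))) Pn
    ... | r , (k , e , f) , ¬n = r , (suc k , trans e (shift′ k) , g) , ¬n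
      where
      shift′ : ∀ k → k * c + (p + c) ≡ suc k * c + p
      shift′ k = sym (trans (suc-* k p) (+-assoc (k * c) p c))
      g : ∀ i → i ≤ suc k → P (i * c + p)
      g zero _ = Pp
      g (suc i) (s≤s i≤) = subst P (shift′ i) (f i i≤)

  -- All later facts use only `_↦_`, never the way in which the images are found.
  abstract
    forward : ∀ p → ∃ λ r → p ↦ r
    forward p with P? p | P? (p + c)
    ... | no ¬Pp | _ = p , out ¬Pp
    ... | yes Pp | yes Pn = p + c , next Pp Pn
    ... | yes Pp | no ¬n = let q , r , ¬prev = start p Pp in q , wrap r ¬prev ¬n

    backward : ∀ r → ∃ λ p → p ↦ r
    backward r with P? r | prev? r
    ... | no ¬Pr | _ = r , out ¬Pr
    ... | yes Pr | yes (q , refl , Pq) = q , next Pq Pr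
    ... | yes Pr | no ¬prev = let p , run , ¬n = end r Pr in p , wrap run ¬prev ¬n

  σ τ : ℕ → ℕ
  σ p = proj₁ (forward p)
  τ r = proj₁ (backward r)

  σ-↦ : ∀ {p r} → p ↦ r → σ p ≡ r
  σ-↦ m = ↦-functional (proj₂ (forward _)) m

  σ∘τ : ∀ r → σ (τ r) ≡ r
  σ∘τ r = σ-↦ (proj₂ (backward r))

  τ∘σ : ∀ p → τ (σ p) ≡ p
  τ∘σ p = ↦-injective′ (proj₂ (backward (σ p))) (proj₂ (forward p)) refl

  -- The rotation does not change `bs`, so the rotated word has the same runs. Hence the maps `to`
  -- and `from` of `Move`, each built on the runs of its own argument, are inverse to each other.
  nth-↦ : ∀ {p r} → p ↦ r → nth false bs p ≡ nth false bs r
  nth-↦ (out _) = refl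
  nth-↦ (next p n) = trans p (sym n)
  nth-↦ (wrap r _ _) = trans (run-end r) (sym (run-start r))

  ↦-< : ∀ {p r} → p ↦ r → (p < length bs → r < length bs) × (r < length bs → p < length bs)
  ↦-< (out _) = id , id
  ↦-< (next p n) = (λ _ → P-< n) , (λ _ → P-< p)
  ↦-< (wrap r _ _) = (λ _ → P-< (run-start r)) , (λ _ → P-< (run-end r))

-- Permuting the letters of a word.

module _ {X : Set} (d : X) where

  permute : (ℕ → ℕ) → List X → List X
  permute ρ w = map (nth d w ∘ ρ) (upTo (length w))

  length-permute : ∀ ρ w → length (permute ρ w) ≡ length w
  length-permute ρ w = trans (length-map (nth d w ∘ ρ) (upTo (length w))) (length-upTo (length w))

  nth-permute : ∀ {e} ρ w {k} → k < length w → nth e (permute ρ w) k ≡ nth d w (ρ k)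
  nth-permute {e} ρ w {k} l = trans (cong (λ xs → nth e xs k) (map-upTo (nth d w ∘ ρ) (length w)))
                                    (nth-applyUpTo _ (length w) l)

  permute-inverse : ∀ ρ ρ′ w → (∀ {k} → k < length w → ρ′ k < length w) → (∀ k → ρ (ρ′ k) ≡ k) →
                    permute ρ′ (permute ρ w) ≡ w
  permute-inverse ρ ρ′ w bound inv = nth-ext {d = d} len λ {k} l →
    trans (nth-permute ρ′ (permute ρ w) (subst (k <_) (length-permute ρ′ (permute ρ w)) l))
      (trans (nth-permute ρ w (bound (subst (k <_) len l))) (cong (nth d w) (inv k)))
    where
    len : length (permute ρ′ (permute ρ w)) ≡ length w
    len = trans (length-permute ρ′ (permute ρ w)) (length-permute ρ w)

  permute-↭ : (ρ ρ′ : ℕ → ℕ) (w : List X) → (∀ {k} → k < length w → ρ′ k < length w) → (∀ k → ρ (ρ′ k) ≡ k) →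
              permute ρ w ↭ w
  permute-↭ ρ ρ′ w bound inv = ↭-trans
    (↭-reflexive (map-∘ {g = nth d w} {f = ρ} (upTo n)))
    (↭-trans (↭-map⁺ (nth d w) (↭-sym upTo↭)) (↭-reflexive tabulate-nth))
    where
    n = length w
    upTo↭ : upTo n ↭ map ρ (upTo n)
    upTo↭ = unique-⊆⇒↭ (Unique.upTo⁺ n)
      (λ {k} k∈ → subst (_∈ map ρ (upTo n)) (inv k) (∈-map⁺ ρ (∈-upTo⁺ (bound (∈-upTo⁻ k∈)))))
      (≤-reflexive (length-map ρ (upTo n)))
    tabulate-nth : map (nth d w) (upTo n) ≡ w
    tabulate-nth = nth-ext {d = d} (length-permute id w) λ {k} l →
      nth-permute id w (subst (k <_) (length-permute id w) l)

-- Embeddings and the bijection of words.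

mk : ℕ → ℙ
mk k = suc k , irr _

-- Embeddings in terms of the letters, those outside the word being 0.
record Embeds (u w : List ℕ) (i : ℕ) : Set where
  constructor embeds
  field
    fits : i + length u ≤ length w
    below : ∀ k → at u k ≤ at w (i + k)

at-letters : ∀ (w : Word) (i : Fin (length w)) → at (letters w) (toℕ i) ≡ value (lookup w i)
at-letters w i = trans (nth-map value {d = mk 0} w (toℕ<n i)) (cong value (nth-lookup (mk 0) w i))

length-letters : ∀ (w : Word) → length (letters w) ≡ length w
length-letters = length-map value

Em⇒Embeds : ∀ u w i → Em u w i → Embeds (letters u) (letters w) i
Em⇒Embeds u w i (fits , f) = embeds
  (subst₂ (λ a b → i + a ≤ b) (sym (length-letters u)) (sym (length-letters w)) fits) below
  where
  below : ∀ k → at (letters u) k ≤ at (letters w) (i + k)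
  below k with k <? length u
  ... | no ¬l = ≤-trans (≤-reflexive (nth-≥ (letters u) (subst (_≤ k) (sym (length-letters u)) (≮⇒≥ ¬l)))) z≤n
  ... | yes l = subst₂ _≤_
    (trans (sym (at-letters u (Fin.fromℕ< l))) (cong (at (letters u)) (toℕ-fromℕ< l)))
    (trans (sym (at-letters w _)) (cong (at (letters w))
      (trans (toℕ-inject≤ _ fits) (trans (toℕ-↑ʳ i _) (cong (i +_) (toℕ-fromℕ< l))))))
    (f (Fin.fromℕ< l))

Embeds⇒Em : ∀ u w i → Embeds (letters u) (letters w) i → Em u w i
Embeds⇒Em u w i (embeds fits below) = fits′ , λ k → subst₂ _≤_ (at-letters u k)
    (trans (cong (at (letters w)) (sym (trans (toℕ-inject≤ _ fits′) (toℕ-↑ʳ i k)))) (at-letters w _))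
    (below (toℕ k))
  where
  fits′ : i + length u ≤ length w
  fits′ = subst₂ (λ a b → i + a ≤ b) (length-letters u) (length-letters w) fits

-- u and v agree in their letters below h, and the other letters of v are those
-- of u moved c places to the left, with one letter h moved to the right end.
record Moved (h c : ℕ) (u v : ℕ → ℕ) : Set where
  field
    level   : ∀ {k} → h ≤ u k → h ≤ v k
    level′  : ∀ {k} → h ≤ v k → h ≤ u k
    lower   : ∀ {k} → u k < h → u k ≡ v k
    target  : ∀ {k} → h ≤ u k → v k ≡ h ⊎ (h ≤ u (k + c) × v k ≡ u (k + c))
    source  : ∀ {k} → h ≤ u k → u k ≡ h ⊎ ∃ λ k′ → k ≡ k′ + c × h ≤ u k′ × u k ≡ v k′

module Move (h c : ℕ) (0<h : 0 < h) (0<c : 0 < c) where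

  high : Word → List Bool
  high = map (λ x → does (h ≤? value x))

  module R (w : Word) = Rotation c 0<c (high w)

  to from : Word → Word
  to   w = permute (mk 0) (R.σ w) w
  from w = permute (mk 0) (R.τ w) w

  private
    len-high : ∀ w → length (high w) ≡ length w
    len-high = length-map _

    σ-< : ∀ w {k} → k < length w → R.σ w k < length w
    σ-< w {k} l = subst (R.σ w k <_) (len-high w) (proj₁ (R.↦-< w (proj₂ (R.forward w k))) (subst (k <_) (sym (len-high w)) l))

    τ-< : ∀ w {k} → k < length w → R.τ w k < length w
    τ-< w {k} l = subst (R.τ w k <_) (len-high w) (proj₂ (R.↦-< w (proj₂ (R.backward w k))) (subst (k <_) (sym (len-high w)) l))

    nth-high : ∀ w {k} → k < length w → nth false (high w) k ≡ does (h ≤? value (nth (mk 0) w k))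
    nth-high w l = nth-map _ w l

    high-permute : ∀ w ρ → (∀ {k} → k < length w → ρ k < length w) →
                   (∀ k → nth false (high w) (ρ k) ≡ nth false (high w) k) → high (permute (mk 0) ρ w) ≡ high w
    high-permute w ρ bound inv = nth-ext {d = false} len λ {k} l → go (subst (k <_) (trans len (len-high w)) l)
      where
      len : length (high (permute (mk 0) ρ w)) ≡ length (high w)
      len = trans (len-high (permute (mk 0) ρ w)) (trans (length-permute (mk 0) ρ w) (sym (len-high w)))
      go : ∀ {k} → k < length w → nth false (high (permute (mk 0) ρ w)) k ≡ nth false (high w) k
      go {k} l = trans (nth-high (permute (mk 0) ρ w) (subst (k <_) (sym (length-permute (mk 0) ρ w)) l))
        (trans (cong (λ x → does (h ≤? value x)) (nth-permute (mk 0) ρ w l))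
        (trans (sym (nth-high w (bound l))) (inv k)))

    high-to : ∀ w → high (to w) ≡ high w
    high-to w = high-permute w (R.σ w) (σ-< w) λ k → sym (R.nth-↦ w (proj₂ (R.forward w k)))

    high-from : ∀ w → high (from w) ≡ high w
    high-from w = high-permute w (R.τ w) (τ-< w) λ k → R.nth-↦ w (proj₂ (R.backward w k))

  to∘from : ∀ w → to (from w) ≡ w
  to∘from w = trans (cong (λ bs → permute (mk 0) (Rotation.σ c 0<c bs) (from w)) (high-from w))
                    (permute-inverse (mk 0) (R.τ w) (R.σ w) w (σ-< w) (R.τ∘σ w))

  from∘to : ∀ w → from (to w) ≡ w
  from∘to w = trans (cong (λ bs → permute (mk 0) (Rotation.τ c 0<c bs) (to w)) (high-to w))
                    (permute-inverse (mk 0) (R.σ w) (R.τ w) w (τ-< w) (R.σ∘τ w))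

  P⇒≤ : ∀ w {k} → R.P w k → h ≤ at (letters w) k
  P⇒≤ w {k} Pk = subst (h ≤_) (sym (nth-map value w l)) (high⇒≤ (trans (sym (nth-high w l)) Pk))
    where
    l : k < length w
    l = subst (k <_) (len-high w) (R.P-< w Pk)
    high⇒≤ : ∀ {m} → does (h ≤? m) ≡ true → h ≤ m
    high⇒≤ {m} e = ≤ᵇ⇒≤ h m (subst T (sym e) _)

  ≤⇒P : ∀ w {k} → h ≤ at (letters w) k → R.P w k
  ≤⇒P w {k} h≤ with k <? length w
  ... | yes l = trans (nth-high w l) (dec-true (h ≤? _) (subst (h ≤_) (nth-map value w l) h≤))
  -- Outside the word the letter counts as 0, which is below the positive `h`.
  ... | no ¬l = contradiction (<-≤-trans 0<h (≤-trans h≤ (≤-reflexive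
                  (nth-≥ (letters w) (subst (_≤ k) (sym (length-letters w)) (≮⇒≥ ¬l)))))) λ ()

  at-to : ∀ w k → at (letters (to w)) k ≡ at (letters w) (R.σ w k)
  at-to w k with k <? length w
  ... | yes l = trans (nth-map value {d = mk 0} (to w) (subst (k <_) (sym (length-permute (mk 0) _ w)) l))
                 (trans (cong value (nth-permute (mk 0) (R.σ w) w l)) (sym (nth-map value w (σ-< w l))))
  ... | no ¬l = trans (nth-≥ (letters (to w)) (subst (_≤ k) (sym (trans (length-letters (to w)) (length-permute (mk 0) _ w))) (≮⇒≥ ¬l)))
      (sym (trans (cong (at (letters w)) (R.σ-↦ w (R.out λ Pk → ¬l (subst (k <_) (len-high w) (R.P-< w Pk)))))
                  (nth-≥ (letters w) (subst (_≤ k) (sym (length-letters w)) (≮⇒≥ ¬l)))))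

  σ-≤ : ∀ w {k} → h ≤ at (letters w) k → h ≤ at (letters w) (R.σ w k)
  σ-≤ w {k} h≤ = P⇒≤ w (trans (sym (R.nth-↦ w (proj₂ (R.forward w k)))) (≤⇒P w h≤))

  ≤-σ : ∀ w {k} → h ≤ at (letters w) (R.σ w k) → h ≤ at (letters w) k
  ≤-σ w {k} h≤ = P⇒≤ w (trans (R.nth-↦ w (proj₂ (R.forward w k))) (≤⇒P w h≤))

  σ-next : ∀ w {k} → h ≤ at (letters w) k → h ≤ at (letters w) (k + c) → R.σ w k ≡ k + c
  σ-next w h≤ h≤′ = R.σ-↦ w (R.next (≤⇒P w h≤) (≤⇒P w h≤′))

  σ-out : ∀ w {k} → at (letters w) k < h → R.σ w k ≡ k
  σ-out w l = R.σ-↦ w (R.out λ Pk → <⇒≱ l (P⇒≤ w Pk))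

  private
    module _ {u v : ℕ → ℕ} (M : Moved h c u v) (w : Word) (i : ℕ) where
      open Moved M
      W = at (letters w)

      assoc : ∀ k → i + k + c ≡ i + (k + c)
      assoc k = +-assoc i k c

      -- If `u k` is low, the place in `w` is either low and fixed, or high and receives a high
      -- letter. If `u k` is high, `v k` is either `h`, and any high letter will do, or `u (k + c)`;
      -- then `w` is high at `i + k` and at `i + k + c`, so the second of these letters moves to the
      -- first place.
      move-below : (∀ k → u k ≤ W (i + k)) → ∀ k → v k ≤ W (R.σ w (i + k))
      move-below f k with h ≤? u k
      ... | no ¬h with h ≤? W (i + k)
      ...   | yes hW = ≤-trans (≤-reflexive (sym (lower (≰⇒> ¬h)))) (≤-trans (<⇒≤ (≰⇒> ¬h)) (σ-≤ w hW))
      ...   | no ¬hW = subst₂ _≤_ (lower (≰⇒> ¬h)) (cong W (sym (σ-out w (≰⇒> ¬hW)))) (f k)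
      move-below f k | yes h≤ with target h≤
      ... | inj₁ e = subst (_≤ W (R.σ w (i + k))) (sym e) (σ-≤ w (≤-trans h≤ (f k)))
      ... | inj₂ (h≤′ , e) = subst₂ _≤_ (sym e)
              (cong W (sym (trans (σ-next w (≤-trans h≤ (f k)) (subst (λ z → h ≤ W z) (sym (assoc k)) (≤-trans h≤′ (f (k + c))))) (assoc k))))
              (f (k + c))

      unmove-below : (∀ k → v k ≤ W (R.σ w (i + k))) → ∀ k → u k ≤ W (i + k)
      unmove-below g k with h ≤? u k
      ... | no ¬h with h ≤? W (i + k)
      ...   | yes hW = ≤-trans (<⇒≤ (≰⇒> ¬h)) hW
      ...   | no ¬hW = subst₂ _≤_ (sym (lower (≰⇒> ¬h))) (cong W (σ-out w (≰⇒> ¬hW))) (g k)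
      unmove-below g k | yes h≤ with source h≤
      ... | inj₁ e = subst (_≤ W (i + k)) (sym e) (≤-σ w (≤-trans (level h≤) (g k)))
      -- Here `k` is `k′ + c`. As `w` is high at `i + k′` and at `i + k`, the rotation brings the
      -- letter at `i + k` to `i + k′`, where it bounds `v k′`, which equals `u k`.
      ... | inj₂ (k′ , refl , h≤′ , e) = subst₂ _≤_ (sym e)
              (cong W (trans (σ-next w (≤-σ w (≤-trans (level h≤′) (g k′)))
                                       (subst (λ z → h ≤ W z) (sym (assoc k′)) (≤-σ w (≤-trans (level h≤) (g (k′ + c)))))) (assoc k′)))
              (g k′)

  moved⇒∼ss : ∀ u v → length u ≡ length v → Moved h c (at (letters u)) (at (letters v)) → u ∼ss v
  moved⇒∼ss u v len M = record
    { bijection        = mk↔ₛ′ to from to∘from from∘to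
    ; preserves-length = λ w → length-permute (mk 0) (R.σ w) w
    ; preserves-sum    = λ w → sum-↭ (↭-map⁺ value (permute-↭ (mk 0) (R.σ w) (R.τ w) w (τ-< w) (R.σ∘τ w)))
    ; preserves-Em     = λ w →
        (λ {i} e → let embeds fits below = Em⇒Embeds u w i e in Embeds⇒Em v (to w) i (embeds
           (subst₂ (λ a b → i + a ≤ b) len′ (sym (len-to w)) fits)
           (λ k → subst (at (letters v) k ≤_) (sym (at-to w (i + k))) (move-below M w i below k)))) ,
        (λ {i} e → let embeds fits below = Em⇒Embeds v (to w) i e in Embeds⇒Em u w i (embeds
           (subst₂ (λ a b → i + a ≤ b) (sym len′) (len-to w) fits)
           (unmove-below M w i λ k → subst (at (letters v) k ≤_) (at-to w (i + k)) (below k))))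
    }
    where
    len′ : length (letters u) ≡ length (letters v)
    len′ = trans (length-letters u) (trans len (sym (length-letters v)))
    len-to : ∀ w → length (letters (to w)) ≡ length (letters w)
    len-to w = trans (length-letters (to w)) (trans (length-permute (mk 0) _ w) (sym (length-letters w)))

-- Places of elements in a list.

unique-++ʳ : ∀ {X : Set} (xs : List X) {ys} → Unique (xs ++ ys) → Unique ys
unique-++ʳ [] u = u
unique-++ʳ (_ ∷ xs) (_ ∷ u) = unique-++ʳ xs u

unique-++-disjoint : ∀ {X : Set} (xs : List X) {ys z} → Unique (xs ++ ys) → z ∈ xs → z ∉ ys
unique-++-disjoint (x ∷ xs) (px ∷ _) (here refl) z∈ys = All.lookup px (∈-++⁺ʳ xs z∈ys) refl
unique-++-disjoint (x ∷ xs) (_ ∷ u) (there z∈xs) = unique-++-disjoint xs u z∈xs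

idx : ℕ → List ℕ → ℕ
idx p [] = 0
idx p (x ∷ xs) with p ≟ x
... | yes _ = 0
... | no _  = suc (idx p xs)

idx-here : ∀ x xs → idx x (x ∷ xs) ≡ 0
idx-here x xs with x ≟ x
... | yes _ = refl
... | no x≢x = contradiction refl x≢x

idx-there : ∀ {p x} xs → p ≢ x → idx p (x ∷ xs) ≡ suc (idx p xs)
idx-there {p} {x} xs p≢x with p ≟ x
... | yes e = contradiction e p≢x
... | no _ = refl

idx-< : ∀ {p xs} → p ∈ xs → idx p xs < length xs
idx-< {p} {x ∷ xs} p∈ with p ≟ x
idx-< p∈ | yes _ = z<s
idx-< (here e) | no p≢x = contradiction e p≢x
idx-< (there p∈) | no _ = s≤s (idx-< p∈)

at-idx : ∀ {p xs} → p ∈ xs → at xs (idx p xs) ≡ p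
at-idx {p} {x ∷ xs} p∈ with p ≟ x
at-idx p∈ | yes e = sym e
at-idx (here e) | no p≢x = contradiction e p≢x
at-idx (there p∈) | no _ = at-idx p∈

idx-at : ∀ {xs k} → Unique xs → k < length xs → idx (at xs k) xs ≡ k
idx-at {x ∷ xs} {zero} _ _ = idx-here x xs
idx-at {x ∷ xs} {suc k} u@(_ ∷ u′) (s≤s l) =
  trans (idx-there xs λ e → head∉tail u (subst (_∈ xs) e (nth-∈ xs l))) (cong suc (idx-at u′ l))

idx-++ˡ : ∀ {p ys} s → p ∈ ys → idx p (ys ++ s) ≡ idx p ys
idx-++ˡ {p} {y ∷ ys} s p∈ with p ≟ y
idx-++ˡ s p∈ | yes _ = refl
idx-++ˡ s (here e) | no p≢y = contradiction e p≢y
idx-++ˡ s (there p∈) | no _ = cong suc (idx-++ˡ s p∈)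

idx-++ʳ : ∀ {p} ys s → p ∉ ys → idx p (ys ++ s) ≡ length ys + idx p s
idx-++ʳ [] s p∉ = refl
idx-++ʳ {p} (y ∷ ys) s p∉ with p ≟ y
... | yes e = contradiction (here e) p∉
... | no _ = cong suc (idx-++ʳ ys s (p∉ ∘ there))

idx-map : ∀ c z s → idx (c + z) (map (c +_) s) ≡ idx z s
idx-map c z [] = refl
idx-map c z (x ∷ s) with z ≟ x | c + z ≟ c + x
... | yes _ | yes _ = refl
... | yes e | no ne = contradiction (cong (c +_) e) ne
... | no ne | yes e = contradiction (+-cancelˡ-≡ c z x e) ne
... | no _ | no _ = cong suc (idx-map c z s)

-- Permutations and the positions of their letters.

length-⟦⟧ : ∀ n → length ⟦ n ⟧ ≡ n
length-⟦⟧ n = trans (length-map suc (upTo n)) (length-upTo n)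

∈⟦⟧⁺ : ∀ {n k} → k < n → suc k ∈ ⟦ n ⟧
∈⟦⟧⁺ l = ∈-map⁺ suc (∈-upTo⁺ l)

∈⟦⟧⁻ : ∀ {n p} → p ∈ ⟦ n ⟧ → ∃ λ k → k < n × p ≡ suc k
∈⟦⟧⁻ p∈ with ∈-map⁻ suc p∈
... | k , k∈ , e = k , ∈-upTo⁻ k∈ , e

⟦⟧-unique : ∀ n → Unique ⟦ n ⟧
⟦⟧-unique n = Unique.map⁺ suc-injective (Unique.upTo⁺ n)

at-⟦⟧ : ∀ {n k} → k < n → at ⟦ n ⟧ k ≡ suc k
at-⟦⟧ {n} {k} l = trans (cong (λ xs → at xs k) (map-upTo suc n)) (nth-applyUpTo suc n l)

-- A permutation is handled through the list s of the positions of its letters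
-- 1, 2, …; the letter at position p is thus 1 + idx p s.
word : ℕ → List ℕ → Word
word n s = map (λ p → mk (idx p s)) ⟦ n ⟧

inv : ℕ → List ℕ → List ℕ
inv n s = map (λ p → suc (idx p s)) ⟦ n ⟧

letters-word : ∀ n s → letters (word n s) ≡ inv n s
letters-word n s = sym (map-∘ ⟦ n ⟧)

length-word : ∀ n s → length (word n s) ≡ n
length-word n s = trans (length-map _ ⟦ n ⟧) (length-⟦⟧ n)

length-inv : ∀ n s → length (inv n s) ≡ n
length-inv n s = trans (length-map _ ⟦ n ⟧) (length-⟦⟧ n)

at-inv : ∀ {n k} s → k < n → at (inv n s) k ≡ suc (idx (suc k) s)
at-inv {n} s l = trans (nth-map _ {d = 0} ⟦ n ⟧ (subst (_ <_) (sym (length-⟦⟧ n)) l))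
                       (cong (λ p → suc (idx p s)) (at-⟦⟧ l))

at-inv-≥ : ∀ {n k} s → n ≤ k → at (inv n s) k ≡ 0
at-inv-≥ {n} s l = nth-≥ (inv n s) (≤-trans (≤-reflexive (length-inv n s)) l)

module _ {n s} (s↭ : s ↭ ⟦ n ⟧) where

  perm-length : length s ≡ n
  perm-length = trans (↭-length s↭) (length-⟦⟧ n)

  perm-unique : Unique s
  perm-unique = unique-↭ (↭-sym s↭) (⟦⟧-unique n)

  inv-↭ : inv n s ↭ ⟦ n ⟧
  inv-↭ = ↭-sym (unique-⊆⇒↭ (⟦⟧-unique n) ⊆inv (≤-reflexive (length-map _ ⟦ n ⟧)))
    where
    ⊆inv : ⟦ n ⟧ ⊆ inv n s
    ⊆inv p∈ with ∈⟦⟧⁻ p∈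
    ... | k , l , refl = subst (λ z → suc z ∈ inv n s) (idx-at perm-unique l′)
                           (∈-map⁺ _ (∈-resp-↭ s↭ (nth-∈ s l′)))
      where l′ = subst (k <_) (sym perm-length) l

inv-involutive : ∀ {n s} → s ↭ ⟦ n ⟧ → inv n (inv n s) ≡ s
inv-involutive {n} {s} s↭ = nth-ext {d = 0} (trans (length-inv n (inv n s)) (sym (perm-length s↭))) λ {k} l →
    go (subst (k <_) (length-inv n (inv n s)) l)
  where
  go : ∀ {k} → k < n → at (inv n (inv n s)) k ≡ at s k
  go {k} l with ∈⟦⟧⁻ (∈-resp-↭ s↭ (nth-∈ {d = 0} s (subst (k <_) (sym (perm-length s↭)) l)))
  ... | q , q< , e = trans (at-inv (inv n s) l) (trans (cong suc idx≡q) (sym e))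
    where
    at-q : at (inv n s) q ≡ suc k
    at-q = trans (at-inv s q<) (cong suc (trans (cong (λ z → idx z s) (sym e))
             (idx-at (perm-unique s↭) (subst (k <_) (sym (perm-length s↭)) l))))
    idx≡q : idx (suc k) (inv n s) ≡ q
    idx≡q = trans (cong (λ z → idx z (inv n s)) (sym at-q))
      (idx-at (perm-unique (inv-↭ s↭)) (subst (q <_) (sym (length-inv n s)) q<))

word-𝒮 : ∀ {n s} → s ↭ ⟦ n ⟧ → 𝒮 n (word n s)
word-𝒮 {n} {s} s↭ = subst (_↭ ⟦ n ⟧) (sym (letters-word n s)) (inv-↭ s↭)

letters-injective : ∀ {u v} → letters u ≡ letters v → u ≡ v
letters-injective = map-injective value-injective

word-inv : ∀ {n u} → 𝒮 n u → word n (inv n (letters u)) ≡ u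
word-inv {n} {u} u∈ = letters-injective (trans (letters-word n (inv n (letters u))) (inv-involutive u∈))

word-injective : ∀ {n s t} → s ↭ ⟦ n ⟧ → t ↭ ⟦ n ⟧ → word n s ≡ word n t → s ≡ t
word-injective {n} {s} {t} s↭ t↭ e = trans (sym (inv-involutive s↭)) (trans
  (cong (inv n) (trans (sym (letters-word n s)) (trans (cong letters e) (letters-word n t)))) (inv-involutive t↭))

-- Sufficiency: the elementary move and its iteration.

module _ {n c x y : ℕ} (ys s : List ℕ) (0<c : 0 < c)
         (perm : ys ++ x ∷ map (c +_) s ↭ ⟦ n ⟧) (same-set : x ∷ map (c +_) s ↭ y ∷ s) where

  private
    perm′ : ys ++ y ∷ s ↭ ⟦ n ⟧
    perm′ = ↭-trans (++⁺ˡ ys (↭-sym same-set)) perm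

    -- The letter that moves: it stands at `x` in the first word and at `y` in the second, and the
    -- smaller letters have the positions `ys` in both.
    h = suc (length ys)

    U V : ℕ → ℕ
    U = at (inv n (ys ++ x ∷ map (c +_) s))
    V = at (inv n (ys ++ y ∷ s))

    -- Places beyond the word count as low, as both functions are 0 there.
    data View (k : ℕ) : Set where
      low  : U k < h → U k ≡ V k → View k
      high : suc k ∈ y ∷ s → View k

    high-< : ∀ {k} → suc k ∈ y ∷ s → k < n
    high-< p∈ with ∈⟦⟧⁻ (∈-resp-↭ perm′ (∈-++⁺ʳ ys p∈))
    ... | _ , l , refl = l

    U-high : ∀ {k} → suc k ∈ y ∷ s → U k ≡ h + idx (suc k) (x ∷ map (c +_) s)
    U-high p∈ = trans (at-inv (ys ++ x ∷ map (c +_) s) (high-< p∈))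
      (cong suc (idx-++ʳ ys _ (λ p∈ys → unique-++-disjoint ys (perm-unique perm′) p∈ys p∈)))

    V-high : ∀ {k} → suc k ∈ y ∷ s → V k ≡ h + idx (suc k) (y ∷ s)
    V-high p∈ = trans (at-inv (ys ++ y ∷ s) (high-< p∈))
      (cong suc (idx-++ʳ ys _ (λ p∈ys → unique-++-disjoint ys (perm-unique perm′) p∈ys p∈)))

    view : ∀ k → View k
    view k with k <? n
    ... | no ¬l = low (subst (_< h) (sym (at-inv-≥ (ys ++ x ∷ map (c +_) s) (≮⇒≥ ¬l))) z<s)
                      (trans (at-inv-≥ (ys ++ x ∷ map (c +_) s) (≮⇒≥ ¬l)) (sym (at-inv-≥ (ys ++ y ∷ s) (≮⇒≥ ¬l))))
    ... | yes l with ∈-++⁻ ys (∈-resp-↭ (↭-sym perm′) (∈⟦⟧⁺ l))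
    ...   | inj₂ p∈ = high p∈
    ...   | inj₁ p∈ = low (subst (_< h) (sym eU) (s≤s (idx-< p∈))) (trans eU (sym eV))
      where
      eU = trans (at-inv (ys ++ x ∷ map (c +_) s) l) (cong suc (idx-++ˡ (x ∷ map (c +_) s) p∈))
      eV = trans (at-inv (ys ++ y ∷ s) l) (cong suc (idx-++ˡ (y ∷ s) p∈))

    U≥h : ∀ {k} → suc k ∈ y ∷ s → h ≤ U k
    U≥h p∈ = subst (h ≤_) (sym (U-high p∈)) (m≤m+n h _)

    V≥h : ∀ {k} → suc k ∈ y ∷ s → h ≤ V k
    V≥h p∈ = subst (h ≤_) (sym (V-high p∈)) (m≤m+n h _)

    unique-ys : Unique (y ∷ s)
    unique-ys = unique-++ʳ ys (perm-unique perm′)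

    x∉ : x ∉ map (c +_) s
    x∉ = head∉tail (unique-↭ (↭-sym same-set) unique-ys)

    y∉ : y ∉ s
    y∉ = head∉tail unique-ys

    -- The letter of z ∈ s in V is that of c + z in U.
    V≡U : ∀ {k k′} → suc k ∈ s → suc k′ ≡ c + suc k → V k ≡ U k′
    V≡U {k} {k′} z∈ e = trans (V-high (there z∈)) (trans (cong (h +_) (trans
        (idx-there s (λ { refl → y∉ z∈ })) (sym (trans
          (idx-there (map (c +_) s) (λ { refl → x∉ cz∈ }))
          (cong suc (trans (cong (λ q → idx q (map (c +_) s)) e) (idx-map c (suc k) s)))))))
      (sym (U-high (∈-resp-↭ same-set (there cz∈)))))
      where
      cz∈ : suc k′ ∈ map (c +_) s
      cz∈ = subst (_∈ map (c +_) s) (sym e) (∈-map⁺ (c +_) z∈)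

    moved : Moved h c U V
    moved = record
      { level  = λ {k} → level {k}
      ; level′ = λ {k} → level′ {k}
      ; lower  = λ {k} → lower {k}
      ; target = λ {k} → target {k}
      ; source = λ {k} → source {k}
      }
      where
      level : ∀ {k} → h ≤ U k → h ≤ V k
      level {k} l with view k
      ... | low l′ _ = contradiction l (<⇒≱ l′)
      ... | high p∈ = V≥h p∈
      level′ : ∀ {k} → h ≤ V k → h ≤ U k
      level′ {k} l with view k
      ... | low l′ e = contradiction l (<⇒≱ (subst (_< h) e l′))
      ... | high p∈ = U≥h p∈
      lower : ∀ {k} → U k < h → U k ≡ V k
      lower {k} l with view k
      ... | low _ e = e
      ... | high p∈ = contradiction (U≥h p∈) (<⇒≱ l)
      target : ∀ {k} → h ≤ U k → V k ≡ h ⊎ (h ≤ U (k + c) × V k ≡ U (k + c))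
      target {k} l with view k
      ... | low l′ _ = contradiction l (<⇒≱ l′)
      ... | high (here refl) = inj₁ (trans (V-high (here refl)) (trans (cong (h +_) (idx-here y s)) (+-identityʳ h)))
      ... | high (there z∈) = inj₂ (subst (h ≤_) e (V≥h (there z∈)) , e)
        where
        e : V k ≡ U (k + c)
        e = V≡U z∈ (trans (cong suc (+-comm k c)) (sym (+-suc c k)))
      source : ∀ {k} → h ≤ U k → U k ≡ h ⊎ ∃ λ k′ → k ≡ k′ + c × h ≤ U k′ × U k ≡ V k′
      source {k} l with view k
      ... | low l′ _ = contradiction l (<⇒≱ l′)
      ... | high p∈ with ∈-resp-↭ (↭-sym same-set) p∈
      ...   | here e = inj₁ (trans (U-high p∈) (trans (cong (h +_)
                (trans (cong (λ q → idx q (x ∷ map (c +_) s)) e) (idx-here x (map (c +_) s)))) (+-identityʳ h)))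
      ...   | there cz∈ with ∈-map⁻ (c +_) cz∈
      ...     | z , z∈ , e with ∈⟦⟧⁻ (∈-resp-↭ perm′ (∈-++⁺ʳ ys (there z∈)))
      ...       | k′ , _ , refl = inj₂ (k′ , suc-injective (trans e (trans (+-suc c k′) (cong suc (+-comm c k′)))) ,
                                        U≥h (there z∈) , sym (V≡U z∈ e))

  move : word n (ys ++ x ∷ map (c +_) s) ∼ss word n (ys ++ y ∷ s)
  move = Move.moved⇒∼ss h c z<s 0<c (word n (ys ++ x ∷ map (c +_) s)) (word n (ys ++ y ∷ s))
    (trans (length-word n (ys ++ x ∷ map (c +_) s)) (sym (length-word n (ys ++ y ∷ s))))
    (subst₂ (λ u v → Moved h c (at u) (at v)) (sym (letters-word n (ys ++ x ∷ map (c +_) s)))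
            (sym (letters-word n (ys ++ y ∷ s))) moved)

-- Induction over the letters, with `ys` the positions already in agreement. If the sets left after
-- the next position are equal, the next positions are equal too; otherwise one elementary move
-- shifts that set in one word onto the one in the other.
sim⇒∼ss-after : ∀ {n} m ys s t → length s ≡ m → ys ++ s ↭ ⟦ n ⟧ → s ↭ t → Sim s t →
                word n (ys ++ s) ∼ss word n (ys ++ t)
sim⇒∼ss-after m ys [] t len perm p sim with ↭-empty-inv (↭-sym p)
... | refl = ∼ss-refl
sim⇒∼ss-after m ys (x ∷ s) [] len perm p sim = contradiction (↭-length p) λ ()
sim⇒∼ss-after {n} (suc m) ys (x ∷ s) (y ∷ t) len perm p sim = go (translate-view (sim 1))
  where
  reassoc : ∀ {z r r′} → word n ((ys ∷ʳ z) ++ r) ∼ss word n ((ys ∷ʳ z) ++ r′) →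
            word n (ys ++ z ∷ r) ∼ss word n (ys ++ z ∷ r′)
  reassoc {z} {r} {r′} = subst₂ (λ a b → word n a ∼ss word n b) (++-assoc ys [ z ] r) (++-assoc ys [ z ] r′)
  perm-∷ʳ : ∀ {z r} → ys ++ z ∷ r ↭ ⟦ n ⟧ → (ys ∷ʳ z) ++ r ↭ ⟦ n ⟧
  perm-∷ʳ {z} {r} q = ↭-trans (↭-reflexive (++-assoc ys [ z ] r)) q
  unique-xs : Unique (x ∷ s)
  unique-xs = unique-++ʳ ys (perm-unique perm)
  go : TranslateView s t → word n (ys ++ x ∷ s) ∼ss word n (ys ++ y ∷ t)
  go (same q) with ∷-↭-unique (↭-trans p (↭-prep y (↭-sym q))) unique-xs
  ... | refl = reassoc (sim⇒∼ss-after m (ys ∷ʳ x) s t (suc-injective len) (perm-∷ʳ perm) q (sim-tail sim))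
  go (down c 0<c q) with ↭-map-inv (c +_) (↭-sym q)
  ... | s₀ , refl , q₀ = ∼ss-trans (move ys s₀ 0<c perm same-set)
      (reassoc (sim⇒∼ss-after m (ys ∷ʳ y) s₀ t (trans (sym (length-map (c +_) s₀)) (suc-injective len))
        (perm-∷ʳ (↭-trans (++⁺ˡ ys (↭-sym same-set)) perm)) (↭-sym q₀) (sim-trans (sim-map c s₀) (sim-tail sim))))
    where
    same-set : x ∷ map (c +_) s₀ ↭ y ∷ s₀
    same-set = ↭-trans p (↭-prep y q₀)
  go (up c 0<c q) with ↭-map-inv (c +_) (↭-sym q)
  ... | t₀ , refl , q₀ = ∼ss-trans
      (reassoc (sim⇒∼ss-after m (ys ∷ʳ x) s t₀ (suc-injective len) (perm-∷ʳ perm) q₀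
        (sim-trans (sim-tail sim) (sim-sym (sim-map c t₀)))))
      (∼ss-sym (move ys t₀ 0<c (↭-trans (++⁺ˡ ys (↭-sym p)) perm) (↭-trans (↭-sym p) (↭-prep x q₀))))

sim⇒∼ss : ∀ {n s t} → s ↭ ⟦ n ⟧ → t ↭ ⟦ n ⟧ → Sim s t → word n s ∼ss word n t
sim⇒∼ss {n} {s} {t} s↭ t↭ = sim⇒∼ss-after (length s) [] s t refl s↭ (↭-trans s↭ (↭-sym t↭))

-- Finite sums

∑< : ℕ → (ℕ → ℕ) → ℕ
∑< n f = sum (applyUpTo f n)

∑-cong : ∀ n {f g} → (∀ {k} → k < n → f k ≡ g k) → ∑< n f ≡ ∑< n g
∑-cong zero e = refl
∑-cong (suc n) e = cong₂ _+_ (e z<s) (∑-cong n λ l → e (s≤s l))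

∑-mono : ∀ n {f g} → (∀ {k} → k < n → f k ≤ g k) → ∑< n f ≤ ∑< n g
∑-mono zero e = z≤n
∑-mono (suc n) e = +-mono-≤ (e z<s) (∑-mono n λ l → e (s≤s l))

∑-zero : ∀ n {f} → (∀ {k} → k < n → f k ≡ 0) → ∑< n f ≡ 0
∑-zero zero e = refl
∑-zero (suc n) e = cong₂ _+_ (e z<s) (∑-zero n λ l → e (s≤s l))

+-interchange : ∀ a b c d → (a + b) + (c + d) ≡ (a + c) + (b + d)
+-interchange = solve 4 (λ a b c d → (a :+ b) :+ (c :+ d) := (a :+ c) :+ (b :+ d)) refl

∑-+ : ∀ n f g → ∑< n (λ k → f k + g k) ≡ ∑< n f + ∑< n g
∑-+ zero f g = refl
∑-+ (suc n) f g = trans (cong (f 0 + g 0 +_) (∑-+ n (f ∘ suc) (g ∘ suc))) (+-interchange (f 0) (g 0) _ _)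

∑-swap : ∀ m n (f : ℕ → ℕ → ℕ) → ∑< m (λ i → ∑< n (f i)) ≡ ∑< n (λ j → ∑< m (λ i → f i j))
∑-swap zero n f = sym (∑-zero n λ _ → refl)
∑-swap (suc m) n f = trans (cong (∑< n (f 0) +_) (∑-swap m n (f ∘ suc))) (sym (∑-+ n (f 0) _))

∑-split : ∀ m n f → ∑< (m + n) f ≡ ∑< m f + ∑< n (λ k → f (m + k))
∑-split zero n f = refl
∑-split (suc m) n f = trans (cong (f 0 +_) (∑-split m n (f ∘ suc))) (sym (+-assoc (f 0) _ _))

∑-shift : ∀ c n f → (∀ {k} → k < c → f k ≡ 0) → (∀ {k} → n ≤ k → f k ≡ 0) →
          ∑< n (λ k → f (c + k)) ≡ ∑< n f
∑-shift c n f low high = begin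
  ∑< n (λ k → f (c + k))             ≡⟨ cong (_+ ∑< n (λ k → f (c + k))) (∑-zero c low) ⟨
  ∑< c f + ∑< n (λ k → f (c + k))    ≡⟨ ∑-split c n f ⟨
  ∑< (c + n) f                       ≡⟨ cong (λ m → ∑< m f) (+-comm c n) ⟩
  ∑< (n + c) f                       ≡⟨ ∑-split n c f ⟩
  ∑< n f + ∑< c (λ k → f (n + k))    ≡⟨ cong (∑< n f +_) (∑-zero c λ {k} _ → high (m≤m+n n k)) ⟩
  ∑< n f + 0                         ≡⟨ +-identityʳ _ ⟩
  ∑< n f                             ∎
  where open ≡-Reasoning

-- For extracting one level set from an equality of totals over all level sets.
∑-isolate : ∀ n {f g h} → h < n → (∀ {k} → k < n → k ≢ h → f k ≡ g k) → ∑< n f ≡ ∑< n g → f h ≡ g h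
∑-isolate (suc n) {f} {g} {zero} _ e s = +-cancelʳ-≡ _ (f 0) (g 0)
  (trans s (cong (g 0 +_) (sym (∑-cong n λ l → e (s≤s l) λ ()))))
∑-isolate (suc n) {f} {g} {suc h} (s≤s l) e s = ∑-isolate n l (λ l′ ne → e (s≤s l′) (ne ∘ suc-injective))
  (+-cancelˡ-≡ (f 0) _ _ (trans s (cong (_+ ∑< n (g ∘ suc)) (sym (e z<s λ ())))))

≤-∑ : ∀ n f {k} → k < n → f k ≤ ∑< n f
≤-∑ (suc n) f {zero} _ = m≤m+n (f 0) _
≤-∑ (suc n) f {suc k} (s≤s l) = ≤-trans (≤-∑ n (f ∘ suc) l) (m≤n+m _ (f 0))

∑-positive : ∀ n f → 0 < ∑< n f → ∃ λ k → k < n × 0 < f k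
∑-positive (suc n) f l with f 0 in e
... | suc m = 0 , z<s , subst (0 <_) (sym e) z<s
... | zero with ∑-positive n (f ∘ suc) l
...   | k , k< , fk = suc k , s≤s k< , fk

sum-at : ∀ xs → sum xs ≡ ∑< (length xs) (at xs)
sum-at [] = refl
sum-at (x ∷ xs) = cong (x +_) (sum-at xs)

ind : {P : Set} → Dec P → ℕ
ind (yes _) = 1
ind (no _)  = 0

ind-yes : {P : Set} (d : Dec P) → P → ind d ≡ 1
ind-yes (yes _) p = refl
ind-yes (no ¬p) p = contradiction p ¬p

ind-no : {P : Set} (d : Dec P) → ¬ P → ind d ≡ 0
ind-no (yes p) ¬p = contradiction p ¬p
ind-no (no _) ¬p = refl

ind-⇔ : {P Q : Set} (d : Dec P) (e : Dec Q) → (P → Q) → (Q → P) → ind d ≡ ind e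
ind-⇔ d (yes q) f g = ind-yes d (g q)
ind-⇔ d (no ¬q) f g = ind-no d (¬q ∘ f)

ind-positive : {P : Set} (d : Dec P) → 0 < ind d → P
ind-positive (yes p) _ = p

∑-ind-≥ : ∀ n {Q : ℕ → Set} (Q? : ∀ h → Dec (Q h)) m → m ≤ n → (∀ {h} → h < m → Q h) → m ≤ ∑< n (ind ∘ Q?)
∑-ind-≥ n Q? zero _ q = z≤n
∑-ind-≥ (suc n) Q? (suc m) (s≤s l) q = +-mono-≤ (≤-reflexive (sym (ind-yes (Q? 0) (q z<s))))
                                               (∑-ind-≥ n (Q? ∘ suc) m l λ l′ → q (s≤s l′))

∑-ind-≤ : ∀ n {Q : ℕ → Set} (Q? : ∀ h → Dec (Q h)) m → (∀ {h} → h < n → Q h → h < m) → ∑< n (ind ∘ Q?) ≤ m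
∑-ind-≤ zero Q? m q = z≤n
∑-ind-≤ (suc n) Q? m q with Q? 0
... | no _ = ∑-ind-≤ n (Q? ∘ suc) m λ l Qh → <-trans (n<1+n _) (q (s≤s l) Qh)
... | yes Q0 = ≤-trans (s≤s (∑-ind-≤ n (Q? ∘ suc) (m ∸ 1) λ l Qh →
    ≤-pred (≤-trans (q (s≤s l) Qh) (≤-reflexive (sym m≡))))) (≤-reflexive m≡)
  where
  m≡ : 1 + (m ∸ 1) ≡ m
  m≡ = m+[n∸m]≡n (q z<s Q0)

-- Level sets

drop⊆ : ∀ h (s : List ℕ) → drop h s ⊆ s
drop⊆ zero s p∈ = p∈
drop⊆ (suc h) (_ ∷ s) p∈ = there (drop⊆ h s p∈)

∈-drop⁺ : ∀ h {p s} → p ∈ s → h ≤ idx p s → p ∈ drop h s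
∈-drop⁺ zero p∈ l = p∈
∈-drop⁺ (suc h) {p} {x ∷ s} p∈ l with p ≟ x
∈-drop⁺ (suc h) p∈ () | yes _
∈-drop⁺ (suc h) (here e) l | no p≢x = contradiction e p≢x
∈-drop⁺ (suc h) (there p∈) (s≤s l) | no _ = ∈-drop⁺ h p∈ l

∈-drop⁻ : ∀ h {p s} → Unique s → p ∈ drop h s → h ≤ idx p s
∈-drop⁻ zero u p∈ = z≤n
∈-drop⁻ (suc h) {p} {x ∷ s} u@(_ ∷ u′) p∈ = ≤-trans (s≤s (∈-drop⁻ h u′ p∈)) (≤-reflexive (sym
  (idx-there s λ { refl → head∉tail u (drop⊆ h s p∈) })))

infixl 6 _⊕_
_⊕_ : List ℕ → List ℕ → List ℕ
A ⊕ E = cartesianProductWith _+_ A E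

-- One less than the largest letter that the copies of the word at the indices in `E` demand at
-- position `p`, or 0 if none reaches `p`: the list `drop (suc h) s` holds the positions of the
-- letters from `h + 2` on.
levels : ℕ → List ℕ → List ℕ → ℕ → ℕ
levels n s E p = ∑< (n ∸ 1) λ h → ind (p ∈? drop (suc h) s ⊕ E)

-- The least word of length l in which word n s embeds at all indices of E.
least : ℕ → List ℕ → List ℕ → ℕ → Word
least n s E l = applyUpTo (λ k → mk (levels n s E (suc k))) l

letters-least : ∀ n s E l → letters (least n s E l) ≡ applyUpTo (λ k → suc (levels n s E (suc k))) l
letters-least n s E l = map-applyUpTo _ value l

module _ {n s} (s↭ : s ↭ ⟦ n ⟧) (E : List ℕ) (l : ℕ) where

  least-embeds : ∀ {e} → e ∈ E → e + n ≤ l → Em (word n s) (least n s E l) e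
  least-embeds {e} e∈ e≤ = Embeds⇒Em (word n s) (least n s E l) e
    (subst₂ (λ u w → Embeds u w e) (sym (letters-word n s)) (sym (letters-least n s E l)) (embeds
      (subst₂ (λ a b → e + a ≤ b) (sym (length-inv n s)) (sym (length-applyUpTo _ l)) e≤) below))
    where
    below : ∀ k → at (inv n s) k ≤ at (applyUpTo (λ k → suc (levels n s E (suc k))) l) (e + k)
    below k with k <? n
    ... | no ¬l = ≤-trans (≤-reflexive (at-inv-≥ s (≮⇒≥ ¬l))) z≤n
    ... | yes k< = subst₂ _≤_ (sym (at-inv s k<))
        (sym (nth-applyUpTo _ l (≤-trans (+-monoʳ-< e k<) e≤)))
        (s≤s (∑-ind-≥ (n ∸ 1) _ (idx (suc k) s) idx≤ λ {h} h< →
          subst (_∈ drop (suc h) s ⊕ E) (cong suc (+-comm k e)) (∈-cartesianProductWith⁺ _+_ (∈-drop⁺ (suc h) p∈ h<) e∈)))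
      where
      p∈ : suc k ∈ s
      p∈ = ∈-resp-↭ (↭-sym s↭) (∈⟦⟧⁺ k<)
      idx≤ : idx (suc k) s ≤ n ∸ 1
      idx≤ = ≤-pred (≤-trans (idx-< p∈) (≤-trans (≤-reflexive (perm-length s↭)) (m≤n+m∸n n 1)))

  -- A level `h` counted at a place comes from a copy whose letter there is at least `h + 2`. So
  -- every counted `h` is below the letter of `w` minus 1, which bounds their number.
  least-minimal : ∀ w → length w ≡ l → (∀ {e} → e ∈ E → Em (word n s) w e) →
                  sum (letters (least n s E l)) ≤ sum (letters w)
  least-minimal w refl em = subst₂ _≤_ (cong sum (sym (letters-least n s E l)))
    (trans (cong (λ m → ∑< m (at (letters w))) (sym (length-letters w))) (sym (sum-at (letters w))))
    (∑-mono l bound)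
    where
    1≤at : ∀ {k} → k < l → 1 ≤ at (letters w) k
    1≤at {k} k< = subst (1 ≤_) (sym (nth-map value {d = mk 0} w k<)) (1≤value (nth (mk 0) w k))
      where
      1≤value : (x : ℙ) → 1 ≤ value x
      1≤value (suc _ , _) = s≤s z≤n
    bound : ∀ {k} → k < l → suc (levels n s E (suc k)) ≤ at (letters w) k
    bound {k} k< = subst (suc (levels n s E (suc k)) ≤_) (m+[n∸m]≡n (1≤at k<)) (s≤s (∑-ind-≤ (n ∸ 1) _ _ exceed))
      where
      exceed : ∀ {h} → h < n ∸ 1 → suc k ∈ drop (suc h) s ⊕ E → h < at (letters w) k ∸ 1
      exceed {h} h< p∈ with ∈-cartesianProductWith⁻ _+_ (drop (suc h) s) E p∈
      ... | a , e , a∈ , e∈ , eq with ∈⟦⟧⁻ (∈-resp-↭ s↭ (drop⊆ (suc h) s a∈))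
      ...   | i , i< , refl = ≤-pred (subst (suc (suc h) ≤_) (sym (m+[n∸m]≡n (1≤at k<))) (begin
          2 + h                            ≤⟨ s≤s (∈-drop⁻ (suc h) (perm-unique s↭) a∈) ⟩
          suc (idx (suc i) s)              ≡⟨ at-inv s i< ⟨
          at (inv n s) i                   ≡⟨ cong (λ u → at u i) (letters-word n s) ⟨
          at (letters (word n s)) i        ≤⟨ Embeds.below (Em⇒Embeds (word n s) w e (em e∈)) i ⟩
          at (letters w) (e + i)           ≡⟨ cong (at (letters w)) (trans (+-comm e i) (sym (suc-injective eq))) ⟩
          at (letters w) k                 ∎))
        where open ≤-Reasoning

-- The bijection sends the least word for `s` to a word of the same length and sum that contains the
-- other permutation at all indices of `E`.
∼ss⇒least-≤ : ∀ {n s t} → s ↭ ⟦ n ⟧ → t ↭ ⟦ n ⟧ → word n s ∼ss word n t → ∀ E l → (∀ {e} → e ∈ E → e + n ≤ l) →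
  sum (letters (least n t E l)) ≤ sum (letters (least n s E l))
∼ss⇒least-≤ {n} {s} {t} s↭ t↭ eq E l fits = ≤-trans
  (least-minimal t↭ E l (to w) (trans (preserves-length w) (length-applyUpTo _ l))
    (λ e∈ → proj₁ (preserves-Em w) (least-embeds s↭ E l e∈ (fits e∈))))
  (≤-reflexive (preserves-sum w))
  where
  open _∼ss_ eq
  w = least n s E l

∼ss⇒least-≡ : ∀ {n s t} → s ↭ ⟦ n ⟧ → t ↭ ⟦ n ⟧ → word n s ∼ss word n t → ∀ E l → (∀ {e} → e ∈ E → e + n ≤ l) →
  ∑< l (λ k → levels n s E (suc k)) ≡ ∑< l (λ k → levels n t E (suc k))
∼ss⇒least-≡ {n} {s} {t} s↭ t↭ eq E l fits = +-cancelˡ-≡ (∑< l (λ _ → 1)) _ _ (trans (sym (weight s))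
  (trans (≤-antisym (∼ss⇒least-≤ t↭ s↭ (∼ss-sym eq) E l fits) (∼ss⇒least-≤ s↭ t↭ eq E l fits)) (weight t)))
  where
  weight : ∀ s → sum (letters (least n s E l)) ≡ ∑< l (λ _ → 1) + ∑< l (λ k → levels n s E (suc k))
  weight s = trans (cong sum (letters-least n s E l)) (∑-+ l (λ _ → 1) (λ k → levels n s E (suc k)))

-- Translates of A inside B

module Inside (n : ℕ) where

  -- With x = 2n the reflected set x - B lies between n and 2n - 1. Replacing one position `a` in
  -- `A` by another changes p - a by less than n, so all these differences stay in the interval from
  -- 0 to N = 3n.
  x N : ℕ
  x = n + n
  N = x + n

  -- The translate of A by x − p, which may be negative, lies in B.
  Inside : List ℕ → List ℕ → ℕ → Set
  Inside A B p = All (λ a → x + a ∈ map (p +_) B) A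

  inside? : ∀ A B p → Dec (Inside A B p)
  inside? A B p = All.all? (λ a → x + a ∈? map (p +_) B) A

  translates : List ℕ → List ℕ → ℕ
  translates A B = ∑< (N + n) λ k → ind (inside? A B (suc k))

  full : List ℕ
  full = upTo (suc N)

  holes : List ℕ → List ℕ
  holes B = filter (λ e → x ∉? map (e +_) B) full

  1≤ : ∀ {p} → p ∈ ⟦ n ⟧ → 1 ≤ p
  1≤ p∈ with ∈⟦⟧⁻ p∈
  ... | _ , _ , refl = s≤s z≤n

  ≤n : ∀ {p} → p ∈ ⟦ n ⟧ → p ≤ n
  ≤n p∈ with ∈⟦⟧⁻ p∈
  ... | _ , l , refl = l

  module _ {A B : List ℕ} (A⊆ : A ⊆ ⟦ n ⟧) (B⊆ : B ⊆ ⟦ n ⟧) {a₀} (a₀∈ : a₀ ∈ A) where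

    private
      exchange : ∀ a e b → a + e + b ≡ e + b + a
      exchange = solve 3 (λ a e b → a :+ e :+ b := e :+ b :+ a) refl

    -- An element of `A` confines `p`; for an empty `A` every `p` would qualify.
    inside-bounds : ∀ {p} → Inside A B p → n < p × p ≤ N
    inside-bounds {p} all with ∈-map⁻ (p +_) (All.lookup all a₀∈)
    ... | b , b∈ , e = lower , upper
      where
      open ≤-Reasoning
      lower : n < p
      lower = +-cancelʳ-< n n p (begin-strict
        n + n     <⟨ m<m+n x (1≤ (A⊆ a₀∈)) ⟩
        x + a₀    ≡⟨ e ⟩
        p + b     ≤⟨ +-monoʳ-≤ p (≤n (B⊆ b∈)) ⟩
        p + n     ∎)
      upper : p ≤ N
      upper = begin
        p         ≤⟨ m≤m+n p b ⟩
        p + b     ≡⟨ e ⟨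
        x + a₀    ≤⟨ +-monoʳ-≤ x (≤n (A⊆ a₀∈)) ⟩
        N         ∎

    inside⇒∉holes : ∀ {p} → Inside A B p → p ∉ A ⊕ holes B
    inside⇒∉holes {p} all p∈ with ∈-cartesianProductWith⁻ _+_ A (holes B) p∈
    ... | a , e , a∈ , e∈ , refl with ∈-map⁻ (a + e +_) (All.lookup all a∈)
    ...   | b , b∈ , eq = proj₂ (∈-filter⁻ (λ e → x ∉? map (e +_) B) {xs = full} e∈)
              (subst (_∈ map (e +_) B) (sym (+-cancelʳ-≡ a x (e + b) (trans eq (exchange a e b)))) (∈-map⁺ (e +_) b∈))

    inside⇒∈full : ∀ {p} → Inside A B p → p ∈ A ⊕ full
    inside⇒∈full {p} all with ∈-map⁻ (p +_) (All.lookup all a₀∈)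
    ... | b , b∈ , eq = subst (_∈ A ⊕ full) a₀+e≡p
          (∈-cartesianProductWith⁺ _+_ a₀∈ (∈-upTo⁺ (s≤s (≤-trans (m∸n≤m x b) (m≤m+n x n)))))
      where
      a₀+e≡p : a₀ + (x ∸ b) ≡ p
      a₀+e≡p = +-cancelʳ-≡ b _ p (trans (trans (+-assoc a₀ _ b) (cong (a₀ +_)
        (m∸n+n≡m (≤-trans (≤n (B⊆ b∈)) (m≤m+n n n))))) (trans (+-comm a₀ x) eq))

    holes⊆full : ∀ {p} → p ∈ A ⊕ holes B → p ∈ A ⊕ full
    holes⊆full p∈ with ∈-cartesianProductWith⁻ _+_ A (holes B) p∈
    ... | a , e , a∈ , e∈ , refl = ∈-cartesianProductWith⁺ _+_ a∈
            (proj₁ (∈-filter⁻ (λ e → x ∉? map (e +_) B) e∈))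

    -- Let p = a + e with `e` in the interval. As `p` is not in `A ⊕ holes B`, the index `e` is one
    -- of those left out, so x = e + b for some `b` in `B`. This confines `e` so far that p - a′ is
    -- in the interval for every other `a′` in `A`, and then it must be left out as well.
    full∖holes⇒inside : ∀ {p} → p ∈ A ⊕ full → p ∉ A ⊕ holes B → Inside A B p
    full∖holes⇒inside {p} p∈ p∉ with ∈-cartesianProductWith⁻ _+_ A full p∈
    ... | a , e , a∈ , e∈ , refl with x ∈? map (e +_) B
    ...   | no x∉ = contradiction (∈-cartesianProductWith⁺ _+_ a∈ (∈-filter⁺ (λ e → x ∉? map (e +_) B) e∈ x∉)) p∉
    ...   | yes x∈ with ∈-map⁻ (e +_) x∈
    ...     | b , b∈ , x≡ = All.tabulate each
      where
      open ≤-Reasoning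
      n≤e : n ≤ e
      n≤e = +-cancelʳ-≤ n n e (≤-trans (≤-reflexive x≡) (+-monoʳ-≤ e (≤n (B⊆ b∈))))
      each : ∀ {a′} → a′ ∈ A → x + a′ ∈ map (a + e +_) B
      each {a′} a′∈ with x ∈? map (a + e ∸ a′ +_) B
      ... | yes x∈′ with ∈-map⁻ (a + e ∸ a′ +_) x∈′
      ...   | b′ , b′∈ , x≡′ = subst (_∈ map (a + e +_) B) eq (∈-map⁺ (a + e +_) b′∈)
        where
        eq : a + e + b′ ≡ x + a′
        eq = begin-equality
          a + e + b′                 ≡⟨ cong (_+ b′) (m∸n+n≡m (≤-trans (≤n (A⊆ a′∈)) (≤-trans n≤e (m≤n+m e a)))) ⟨
          a + e ∸ a′ + a′ + b′       ≡⟨ trans (+-assoc (a + e ∸ a′) a′ b′) (cong (a + e ∸ a′ +_) (+-comm a′ b′)) ⟩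
          a + e ∸ a′ + (b′ + a′)     ≡⟨ +-assoc (a + e ∸ a′) b′ a′ ⟨
          a + e ∸ a′ + b′ + a′       ≡⟨ cong (_+ a′) x≡′ ⟨
          x + a′                     ∎
      each {a′} a′∈ | no x∉′ = contradiction
        (subst (_∈ A ⊕ holes B) (m+[n∸m]≡n a′≤) (∈-cartesianProductWith⁺ _+_ a′∈
          (∈-filter⁺ (λ e → x ∉? map (e +_) B) (∈-upTo⁺ (s≤s bound)) x∉′))) p∉
        where
        a′≤ : a′ ≤ a + e
        a′≤ = ≤-trans (≤n (A⊆ a′∈)) (≤-trans n≤e (m≤n+m e a))
        bound : a + e ∸ a′ ≤ N
        bound = begin
          a + e ∸ a′   ≤⟨ m∸n≤m (a + e) a′ ⟩
          a + e        ≤⟨ +-mono-≤ (≤n (A⊆ a∈)) (≤-trans (m≤m+n e b) (≤-reflexive (sym x≡))) ⟩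
          n + x        ≡⟨ +-comm n x ⟩
          N            ∎

    ind-full : ∀ p → ind (p ∈? A ⊕ full) ≡ ind (p ∈? A ⊕ holes B) + ind (inside? A B p)
    ind-full p with p ∈? A ⊕ holes B
    ... | yes p∈ = trans (ind-yes (p ∈? A ⊕ full) (holes⊆full p∈))
                     (cong suc (sym (ind-no (inside? A B p) λ i → inside⇒∉holes i p∈)))
    ... | no p∉ = ind-⇔ (p ∈? A ⊕ full) (inside? A B p) (λ p∈ → full∖holes⇒inside p∈ p∉) inside⇒∈full

  -- Shifting `A` by `c` shifts the admissible `p` by `c`. Those of the shifted set exceed `n`,
  -- hence `c`, and are at most `N`, so none is lost at either end of the sum.
  translates-map : ∀ {A B c a₀} → map (c +_) A ⊆ ⟦ n ⟧ → B ⊆ ⟦ n ⟧ → a₀ ∈ A →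
                   translates A B ≡ translates (map (c +_) A) B
  translates-map {A} {B} {c} {a₀} cA⊆ B⊆ a₀∈ = trans
    (∑-cong (N + n) λ {k} _ → ind-⇔ (inside? A B (suc k)) (inside? (map (c +_) A) B (suc (c + k))) (fwd k) (bwd k))
    (∑-shift c (N + n) _ low high)
    where
    fwd : ∀ k → Inside A B (suc k) → Inside (map (c +_) A) B (suc (c + k))
    fwd k all = All.map⁺ (All.map shifted all)
      where
      shifted : ∀ {a} → x + a ∈ map (suc k +_) B → x + (c + a) ∈ map (suc (c + k) +_) B
      shifted {a} a∈ with ∈-map⁻ (suc k +_) a∈
      ... | b , b∈ , e = subst (_∈ map (suc (c + k) +_) B)
        (trans (trans (cong suc (+-assoc c k b)) (sym (+-suc c (k + b)))) (trans (cong (c +_) (sym e))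
          (trans (sym (+-assoc c x a)) (trans (cong (_+ a) (+-comm c x)) (+-assoc x c a)))))
        (∈-map⁺ (suc (c + k) +_) b∈)
    bwd : ∀ k → Inside (map (c +_) A) B (suc (c + k)) → Inside A B (suc k)
    bwd k all = All.map shifted (All.map⁻ all)
      where
      shifted : ∀ {a} → x + (c + a) ∈ map (suc (c + k) +_) B → x + a ∈ map (suc k +_) B
      shifted {a} a∈ with ∈-map⁻ (suc (c + k) +_) a∈
      ... | b , b∈ , e = subst (_∈ map (suc k +_) B)
        (+-cancelˡ-≡ c _ _ (trans (trans (+-suc c (k + b)) (sym (cong suc (+-assoc c k b)))) (trans (sym e)
          (trans (sym (+-assoc x c a)) (trans (cong (_+ a) (+-comm x c)) (+-assoc c x a))))))
        (∈-map⁺ (suc k +_) b∈)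
    c≤n : c ≤ n
    c≤n = ≤-trans (m≤m+n c a₀) (≤n (cA⊆ (∈-map⁺ (c +_) a₀∈)))
    bounds : ∀ {p} → Inside (map (c +_) A) B p → n < p × p ≤ N
    bounds = inside-bounds cA⊆ B⊆ (∈-map⁺ (c +_) a₀∈)
    low : ∀ {k} → k < c → ind (inside? (map (c +_) A) B (suc k)) ≡ 0
    low {k} k< = ind-no (inside? (map (c +_) A) B (suc k)) λ all →
      <⇒≱ (proj₁ (bounds all)) (≤-trans k< c≤n)
    high : ∀ {k} → N + n ≤ k → ind (inside? (map (c +_) A) B (suc k)) ≡ 0
    high {k} l = ind-no (inside? (map (c +_) A) B (suc k)) λ all →
      <⇒≱ (s≤s (≤-trans (m≤m+n N n) l)) (proj₂ (bounds all))

  translates-↭ : ∀ {A A′} B → A ↭ A′ → translates A B ≡ translates A′ B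
  translates-↭ {A} {A′} B p = ∑-cong (N + n) λ {k} _ →
    ind-⇔ (inside? A B (suc k)) (inside? A′ B (suc k)) (All-resp-↭ p) (All-resp-↭ (↭-sym p))

  translates-translate : ∀ {A A′ B a₀ a₁} → A ⊆ ⟦ n ⟧ → A′ ⊆ ⟦ n ⟧ → B ⊆ ⟦ n ⟧ → a₀ ∈ A → a₁ ∈ A′ →
                         Translate A A′ → translates A B ≡ translates A′ B
  translates-translate {B = B} A⊆ A′⊆ B⊆ a₀∈ a₁∈ tr with translate-view tr
  ... | same p = translates-↭ B p
  ... | up c _ p = trans (translates-map (A′⊆ ∘ ∈-resp-↭ (↭-sym p)) B⊆ a₀∈) (sym (translates-↭ B p))
  ... | down c _ p = trans (translates-↭ B p) (sym (translates-map (A⊆ ∘ ∈-resp-↭ (↭-sym p)) B⊆ a₁∈))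

  inside⇒map⊆ : ∀ {A B p} → Inside A B p → map (x +_) A ⊆ map (p +_) B
  inside⇒map⊆ all q∈ with ∈-map⁻ (x +_) q∈
  ... | a , a∈ , refl = All.lookup all a∈

  translates-longer : ∀ {A B} → Unique A → length B < length A → translates A B ≡ 0
  translates-longer {A} {B} u l = ∑-zero (N + n) λ {k} _ → ind-no (inside? A B (suc k)) λ all →
    <⇒≱ l (subst₂ _≤_ (length-map (x +_) A) (length-map (suc k +_) B)
      (unique-⊆⇒length≤ (Unique.map⁺ (+-cancelˡ-≡ x _ _) u) (inside⇒map⊆ {A} {B} all)))

  translates-self : ∀ B → 0 < n → 0 < translates B B
  -- The value p = x gives the identity translation.
  translates-self B 0<n = ≤-trans (≤-reflexive (sym (ind-yes (inside? B B (suc (x ∸ 1)))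
      (All.tabulate λ {a} a∈ → subst (λ q → x + a ∈ map (q +_) B) (sym x≡) (∈-map⁺ (x +_) a∈)))))
    (≤-∑ (N + n) _ (≤-trans (≤-reflexive x≡) (≤-trans (m≤m+n x n) (m≤m+n N n))))
    where
    x≡ : suc (x ∸ 1) ≡ x
    x≡ = m+[n∸m]≡n (≤-trans 0<n (m≤m+n n n))

  translates-positive : ∀ {A B} → Unique A → length B ≡ length A → 0 < translates A B → Translate A B
  translates-positive {A} {B} u l pos with ∑-positive (N + n) _ pos
  ... | k , _ , pos′ = x , suc k , unique-⊆⇒↭ (Unique.map⁺ (+-cancelˡ-≡ x _ _) u)
    (inside⇒map⊆ {A} {B} (ind-positive (inside? A B (suc k)) pos′))
    (≤-reflexive (trans (length-map (suc k +_) B) (trans l (sym (length-map (x +_) A)))))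

  module _ {s t} (s↭ : s ↭ ⟦ n ⟧) (t↭ : t ↭ ⟦ n ⟧) (eq : word n s ∼ss word n t) where

    drop-⊆ : ∀ {r} h → r ↭ ⟦ n ⟧ → drop h r ⊆ ⟦ n ⟧
    drop-⊆ {r} h r↭ = ∈-resp-↭ r↭ ∘ drop⊆ h r

    drop-length : ∀ {r} h → r ↭ ⟦ n ⟧ → length (drop h r) ≡ n ∸ h
    drop-length {r} h r↭ = trans (length-drop h r) (cong (_∸ h) (perm-length r↭))

    drop-nonempty : ∀ {r h} → r ↭ ⟦ n ⟧ → h < n ∸ 1 → ∃ λ a → a ∈ drop (suc h) r
    drop-nonempty {r} {h} r↭ l with drop (suc h) r | drop-length (suc h) r↭
    ... | [] | e = contradiction (sym e) (>⇒≢ (subst (0 <_) (∸-+-assoc n 1 h) (m<n⇒0<n∸m l)))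
    ... | a ∷ _ | _ = a , here refl

    level-sum : ∀ {r B} → r ↭ ⟦ n ⟧ → B ⊆ ⟦ n ⟧ →
      ∑< (N + n) (λ k → levels n r full (suc k)) ≡
      ∑< (N + n) (λ k → levels n r (holes B) (suc k)) + ∑< (n ∸ 1) (λ h → translates (drop (suc h) r) B)
    level-sum {r} {B} r↭ B⊆ = trans (∑-cong (N + n) λ {k} _ → split (suc k)) (trans (∑-+ (N + n) _ _)
      (cong (∑< (N + n) (λ k → levels n r (holes B) (suc k)) +_) (∑-swap (N + n) (n ∸ 1) _)))
      where
      split : ∀ p → levels n r full p ≡ levels n r (holes B) p +
                                        ∑< (n ∸ 1) (λ h → ind (inside? (drop (suc h) r) B p))
      split p = trans (∑-cong (n ∸ 1) λ {h} l →
          ind-full (drop-⊆ (suc h) r↭) B⊆ (proj₂ (drop-nonempty r↭ l)) p) (∑-+ (n ∸ 1) _ _)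

    translates-sum : ∀ {B} → B ⊆ ⟦ n ⟧ →
      ∑< (n ∸ 1) (λ h → translates (drop (suc h) s) B) ≡ ∑< (n ∸ 1) (λ h → translates (drop (suc h) t) B)
    translates-sum {B} B⊆ = +-cancelˡ-≡ (∑< (N + n) (λ k → levels n s (holes B) (suc k))) _ _
      (trans (sym (level-sum s↭ B⊆)) (trans (∼ss⇒least-≡ s↭ t↭ eq full (N + n) full-fits)
      (trans (level-sum t↭ B⊆) (cong (_+ ∑< (n ∸ 1) (λ h → translates (drop (suc h) t) B))
        (sym (∼ss⇒least-≡ s↭ t↭ eq (holes B) (N + n)
          (full-fits ∘ proj₁ ∘ ∈-filter⁻ (λ e → x ∉? map (e +_) B) {xs = full})))))))
      where
      full-fits : ∀ {e} → e ∈ full → e + n ≤ N + n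
      full-fits e∈ = +-monoˡ-≤ n (≤-pred (∈-upTo⁻ e∈))

    -- Test against B = drop (suc h) s: larger level sets of s and t have no
    -- translate inside B, smaller ones equally many by induction.
    level-translate : ∀ d h → n ∸ 1 ≤ h + d → h < n ∸ 1 → Translate (drop (suc h) s) (drop (suc h) t)
    level-translate zero h l h< = contradiction (≤-trans l (≤-reflexive (+-identityʳ h))) (<⇒≱ h<)
    level-translate (suc d) h l h< = translate-sym (translates-positive
        (Unique.drop⁺ (suc h) (perm-unique t↭))
        (trans (drop-length (suc h) s↭) (sym (drop-length (suc h) t↭)))
        (subst (0 <_) (∑-isolate (n ∸ 1) h< others (translates-sum B⊆))
          (translates-self (drop (suc h) s) (≤-trans (≤-trans (s≤s z≤n) h<) (m∸n≤m n 1)))))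
      where
      B⊆ : drop (suc h) s ⊆ ⟦ n ⟧
      B⊆ = drop-⊆ (suc h) s↭
      larger : ∀ {r k} → r ↭ ⟦ n ⟧ → k < h → translates (drop (suc k) r) (drop (suc h) s) ≡ 0
      larger {r} {k} r↭ k< = translates-longer (Unique.drop⁺ (suc k) (perm-unique r↭))
        (subst₂ _<_ (sym (drop-length (suc h) s↭)) (sym (drop-length (suc k) r↭))
          (∸-monoʳ-< (s≤s k<) (≤-trans h< (m∸n≤m n 1))))
      others : ∀ {k} → k < n ∸ 1 → k ≢ h →
        translates (drop (suc k) s) (drop (suc h) s) ≡ translates (drop (suc k) t) (drop (suc h) s)
      others {k} k< k≢h with <-cmp k h
      ... | tri≈ _ e _ = contradiction e k≢h
      ... | tri< k<h _ _ = trans (larger s↭ k<h) (sym (larger t↭ k<h))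
      ... | tri> _ _ h<k = translates-translate (drop-⊆ (suc k) s↭) (drop-⊆ (suc k) t↭) B⊆
              (proj₂ (drop-nonempty s↭ k<)) (proj₂ (drop-nonempty t↭ k<))
              (level-translate d k (≤-trans l (≤-trans (≤-reflexive (+-suc h d)) (+-monoˡ-≤ d h<k))) k<)

    ∼ss⇒sim : Sim s t
    ∼ss⇒sim zero = ↭⇒translate (↭-trans s↭ (↭-sym t↭))
    ∼ss⇒sim (suc h) with h <? n ∸ 1
    ... | yes h< = level-translate n h (≤-trans (m∸n≤m n 1) (m≤n+m n h)) h<
    ... | no ¬h< = subst₂ Translate (sym (empty s↭)) (sym (empty t↭)) (↭⇒translate ↭-refl)
      where
      empty : ∀ {r} → r ↭ ⟦ n ⟧ → drop (suc h) r ≡ []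
      empty r↭ = length-0 (trans (drop-length (suc h) r↭)
        (trans (sym (∸-+-assoc n 1 h)) (m≤n⇒m∸n≡0 (≮⇒≥ ¬h<))))

-- Sums over lists.

∑∈ : {X : Set} → List X → (X → ℕ) → ℕ
∑∈ xs f = sum (map f xs)

module _ {X : Set} where

  ∑∈-cong : (xs : List X) {f g : X → ℕ} → (∀ {x} → x ∈ xs → f x ≡ g x) → ∑∈ xs f ≡ ∑∈ xs g
  ∑∈-cong [] e = refl
  ∑∈-cong (x ∷ xs) e = cong₂ _+_ (e (here refl)) (∑∈-cong xs (e ∘ there))

  ∑∈-∷ʳ : (xs : List X) (x : X) (f : X → ℕ) → ∑∈ (xs ∷ʳ x) f ≡ ∑∈ xs f + f x
  ∑∈-∷ʳ [] x f = +-identityʳ (f x)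
  ∑∈-∷ʳ (y ∷ xs) x f = trans (cong (f y +_) (∑∈-∷ʳ xs x f)) (sym (+-assoc (f y) _ _))

  ∑∈-∑-* : (xs : List X) (n : ℕ) (f : ℕ → X → ℕ) (g : ℕ → ℕ) →
           ∑< n (λ k → ∑∈ xs (f k) * g k) ≡ ∑∈ xs (λ x → ∑< n (λ k → f k x * g k))
  ∑∈-∑-* [] n f g = ∑-zero n λ _ → refl
  ∑∈-∑-* (x ∷ xs) n f g = trans (∑-cong n λ {k} _ → *-distribʳ-+ (g k) (f k x) (∑∈ xs (f k)))
    (trans (∑-+ n (λ k → f k x * g k) (λ k → ∑∈ xs (f k) * g k)) (cong (∑< n (λ k → f k x * g k) +_) (∑∈-∑-* xs n f g)))

  length-concatMap : {Y : Set} (f : X → List Y) (xs : List X) → length (concatMap f xs) ≡ ∑∈ xs (length ∘ f)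
  length-concatMap f [] = refl
  length-concatMap f (x ∷ xs) = trans (length-++ (f x)) (cong (length (f x) +_) (length-concatMap f xs))

  length-none : {xs : List X} → (∀ {x} → x ∉ xs) → length xs ≡ 0
  length-none {[]} _ = refl
  length-none {x ∷ xs} n = contradiction (here refl) n

∑-truncate : ∀ {m n} f → m ≤ n → (∀ {k} → m ≤ k → f k ≡ 0) → ∑< n f ≡ ∑< m f
∑-truncate {m} {n} f l z = trans (cong (λ b → ∑< b f) (sym (m+[n∸m]≡n l))) (trans (∑-split m (n ∸ m) f)
  (trans (cong (∑< m f +_) (∑-zero (n ∸ m) λ {k} _ → z (m≤m+n m k))) (+-identityʳ _)))

-- Affine invariance

periodic-affine⁺ : ∀ c b {A} → Periodic A → Periodic (map (λ x → x * c + b) A)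
periodic-affine⁺ c b {A} (l , p , linked) = ≤-trans l (≤-reflexive (sym (length-map (λ x → x * c + b) A))) , p * c ,
  Linked.map⁺ (Linked.map (λ { {x} refl → trans (cong (_+ b) (*-distribʳ-+ c p x)) (+-assoc (p * c) (x * c) b) }) linked)

periodic-affine⁻ : ∀ c b {A} → 0 < c → Periodic (map (λ x → x * c + b) A) → Periodic A
periodic-affine⁻ c b {x₀ ∷ x₁ ∷ A} 0<c (_ , p , e₀ ∷ linked) = s≤s (s≤s z≤n) , x₁ ∸ x₀ ,
    Linked.map scale (Linked.map⁻ {xs = x₀ ∷ x₁ ∷ A} (e₀ ∷ linked))
  where
  unshift : ∀ x y → y * c + b ≡ p + (x * c + b) → y * c ≡ p + x * c
  unshift x y e = +-cancelʳ-≡ b _ _ (trans e (sym (+-assoc p (x * c) b)))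
  -- The period of the image is the difference of its first two terms, hence a multiple of `c`.
  p≡ : p ≡ (x₁ ∸ x₀) * c
  p≡ = sym (trans (*-distribʳ-∸ c x₁ x₀) (trans (cong (_∸ x₀ * c) (unshift x₀ x₁ e₀)) (m+n∸n≡m p (x₀ * c))))
  scale : ∀ {x y} → y * c + b ≡ p + (x * c + b) → y ≡ (x₁ ∸ x₀) + x
  scale {x} {y} e = *-cancelʳ-≡ y _ c {{>-nonZero 0<c}}
    (trans (unshift x y e) (trans (cong (_+ x * c) p≡) (sym (*-distribʳ-+ c (x₁ ∸ x₀) x))))
periodic-affine⁻ c b {_ ∷ []} 0<c (s≤s () , _)

picks-map : ∀ (f : ℕ → ℕ) A → picks (map f A) ≡ map (λ (x , B) → f x , map f B) (picks A)
picks-map f [] = refl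
picks-map f (a ∷ A) = cong ((f a , map f A) ∷_) (trans (cong (map _) (picks-map f A))
  (trans (sym (map-∘ (picks A))) (map-∘ (picks A))))

choose-length : ∀ {P Q P′ Q′ : Set} (P? : Dec P) (Q? : Dec Q) (P′? : Dec P′) (Q′? : Dec Q′) e e′ j →
  (P → P′) → (P′ → P) → (Q → Q′) → (Q′ → Q) → (∀ i → length (e i) ≡ length (e′ i)) →
  length (choose P? Q? e j) ≡ length (choose P′? Q′? e′ j)
choose-length (yes p) _ (yes p′) _ e e′ j f g h k l = refl
choose-length (yes p) _ (no ¬p′) _ e e′ j f g h k l = contradiction (f p) ¬p′
choose-length (no ¬p) _ (yes p′) _ e e′ j f g h k l = contradiction (g p′) ¬p
choose-length (no _) (yes q) (no _) (no ¬q′) e e′ j f g h k l = contradiction (h q) ¬q′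
choose-length (no _) (no ¬q) (no _) (yes q′) e e′ j f g h k l = contradiction (k q′) ¬q
choose-length (no _) (yes _) (no _) (yes _) e e′ zero f g h k l = refl
choose-length (no _) (yes _) (no _) (yes _) e e′ (suc j) f g h k l = l j
choose-length (no _) (no _) (no _) (no _) e e′ j f g h k l = l j

length-extend : ∀ m j x B → length (extend m j (x , B)) ≡
  length (choose (periodic? (x ∷ B)) (periodic? (B ∷ʳ x)) (λ i → enum m i B) j)
length-extend m j x B =
  length-map (x ∷_) (choose (periodic? (x ∷ B)) (periodic? (B ∷ʳ x)) (λ i → enum m i B) j)

length-enum : ∀ m j A → length (enum (suc m) j A) ≡ ∑∈ (picks A) (length ∘ extend m j)
length-enum m j A = length-concatMap (extend m j) (picks A)

enum-affine : ∀ c b → 0 < c → ∀ m j A → length (enum m j (map (λ x → x * c + b) A)) ≡ length (enum m j A)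
enum-affine c b 0<c zero zero A = refl
enum-affine c b 0<c zero (suc j) A = refl
enum-affine c b 0<c (suc m) j A = begin
  length (enum (suc m) j (map φ A))                               ≡⟨ length-enum m j (map φ A) ⟩
  ∑∈ (picks (map φ A)) (length ∘ extend m j)                      ≡⟨ cong (λ ps → ∑∈ ps (length ∘ extend m j)) (picks-map φ A) ⟩
  ∑∈ (map (λ (x , B) → φ x , map φ B) (picks A)) (length ∘ extend m j) ≡⟨ cong sum (sym (map-∘ (picks A))) ⟩
  ∑∈ (picks A) (λ (x , B) → length (extend m j (φ x , map φ B)))  ≡⟨ ∑∈-cong (picks A) (λ {p} _ → each p) ⟩
  ∑∈ (picks A) (length ∘ extend m j)                              ≡⟨ length-enum m j A ⟨
  length (enum (suc m) j A)                                       ∎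
  where
  open ≡-Reasoning
  φ : ℕ → ℕ
  φ x = x * c + b
  each : ∀ p → length (extend m j (φ (proj₁ p) , map φ (proj₂ p))) ≡ length (extend m j p)
  each (x , B) = trans (length-extend m j (φ x) (map φ B)) (trans
    (choose-length (periodic? (φ x ∷ map φ B)) (periodic? (map φ B ∷ʳ φ x)) (periodic? (x ∷ B)) (periodic? (B ∷ʳ x))
      (λ i → enum m i (map φ B)) (λ i → enum m i B) j
      (periodic-affine⁻ c b {x ∷ B} 0<c) (periodic-affine⁺ c b {x ∷ B})
      (λ per → periodic-affine⁻ c b {B ∷ʳ x} 0<c (subst Periodic (sym (map-++ φ B [ x ])) per))
      (λ per → subst Periodic (map-++ φ B [ x ]) (periodic-affine⁺ c b {B ∷ʳ x} per))
      (λ i → enum-affine c b 0<c m i B))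
    (sym (length-extend m j x B)))

ap-affine : ∀ a c m → ap a c m ≡ map (λ i → i * c + a) (upTo m)
ap-affine a c m = trans (go a m) (sym (map-upTo _ m))
  where
  go : ∀ a m → ap a c m ≡ applyUpTo (λ i → i * c + a) m
  go a zero = refl
  go a (suc m) = cong (a ∷_) (trans (go (c + a) m) (applyUpTo-cong m λ i →
    trans (sym (+-assoc (i * c) c a)) (cong (_+ a) (+-comm (i * c) c))))
    where
    applyUpTo-cong : ∀ m {f g : ℕ → ℕ} → (∀ i → f i ≡ g i) → applyUpTo f m ≡ applyUpTo g m
    applyUpTo-cong zero e = refl
    applyUpTo-cong (suc m) e = cong₂ _∷_ (e 0) (applyUpTo-cong m (e ∘ suc))

⟦⟧≡ap : ∀ n → ⟦ n ⟧ ≡ ap 1 1 n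
⟦⟧≡ap n = trans (map-cong (λ i → sym (trans (cong (_+ 1) (*-identityʳ i)) (+-comm i 1))) (upTo n)) (sym (ap-affine 1 1 n))

⟦⟧-inc : ∀ n → Inc ⟦ n ⟧
⟦⟧-inc n = subst Inc (sym (⟦⟧≡ap n)) (ap-inc 1 1 n z<s)

#classes : ℕ → ℕ → ℕ
#classes j n = length (enum n j ⟦ n ⟧)

enum-ap : ∀ a c m j → 0 < c → length (enum m j (ap a c m)) ≡ #classes j m
enum-ap a c m j 0<c = begin
  length (enum m j (ap a c m))                           ≡⟨ cong (length ∘ enum m j) (ap-affine a c m) ⟩
  length (enum m j (map (λ i → i * c + a) (upTo m)))     ≡⟨ enum-affine c a 0<c m j (upTo m) ⟩
  length (enum m j (upTo m))                             ≡⟨ enum-affine 1 1 z<s m j (upTo m) ⟨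
  length (enum m j (map (λ i → i * 1 + 1) (upTo m)))     ≡⟨ cong (length ∘ enum m j) (trans (sym (ap-affine 1 1 m)) (sym (⟦⟧≡ap m))) ⟩
  #classes j m                                           ∎
  where open ≡-Reasoning

-- Words after whose last letter the complement is periodic for the first time

stop : {P : Set} → Dec P → ℕ → List (List ℕ) → List (List ℕ)
stop (yes _) zero    ws = [] ∷ []
stop (yes _) (suc k) ws = []
stop (no _)  k       ws = ws

firsts : ℕ → List ℕ → List (List ℕ)
first-step : ℕ → ℕ × List ℕ → List (List ℕ)

firsts zero    A = []
firsts (suc k) A = concatMap (first-step k) (picks A)

first-step k (x , B) = map (x ∷_) (stop (periodic? B) k (firsts k B))

#stop : ℕ → List ℕ → ℕ
#stop k B = length (stop (periodic? B) k (firsts k B))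

length-firsts : ∀ k A → length (firsts (suc k) A) ≡ ∑∈ (picks A) (λ (x , B) → #stop k B)
length-firsts k A = trans (length-concatMap (first-step k) (picks A))
  (∑∈-cong (picks A) λ {(x , B)} _ → length-map (x ∷_) (stop (periodic? B) k (firsts k B)))

#stop-suc : ∀ k {B} → Periodic B → #stop (suc k) B ≡ 0
#stop-suc k {B} per with periodic? B
... | yes _ = refl
... | no ¬per = contradiction per ¬per

#stop-zero : ∀ {B} → Periodic B → #stop 0 B ≡ 1
#stop-zero {B} per with periodic? B
... | yes _ = refl
... | no ¬per = contradiction per ¬per

#stop-no : ∀ k {B} → ¬ Periodic B → #stop k B ≡ length (firsts k B)
#stop-no k {B} ¬per with periodic? B
... | yes per = contradiction per ¬per
... | no _ = refl

extend-keep : ∀ m j {x B} → ¬ Periodic (x ∷ B) → ¬ Periodic (B ∷ʳ x) → length (extend m j (x , B)) ≡ length (enum m j B)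
extend-keep m j {x} {B} ¬f ¬l with periodic? (x ∷ B) | periodic? (B ∷ʳ x)
... | yes f | _ = contradiction f ¬f
... | no _ | yes l = contradiction l ¬l
... | no _ | no _ = length-map (x ∷_) (enum m j B)

extend-flip : ∀ m j {x B} → ¬ Periodic (x ∷ B) → Periodic (B ∷ʳ x) → length (extend m (suc j) (x , B)) ≡ length (enum m j B)
extend-flip m j {x} {B} ¬f l with periodic? (x ∷ B) | periodic? (B ∷ʳ x)
... | yes f | _ = contradiction f ¬f
... | no _ | no ¬l = contradiction l ¬l
... | no _ | yes _ = length-map (x ∷_) (enum m j B)

extend-first : ∀ m j {x B} → Periodic (x ∷ B) → length (extend m j (x , B)) ≡ 0
extend-first m j {x} {B} f with periodic? (x ∷ B)
... | yes _ = refl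
... | no ¬f = contradiction f ¬f

pair-periodic : ∀ {A} → Inc A → length A ≡ 2 → Periodic A
pair-periodic {a ∷ b ∷ []} ((a<b ∷ []) ∷ _) refl = s≤s (s≤s z≤n) , b ∸ a , sym (m∸n+n≡m (<⇒≤ a<b)) ∷ [-]

enum-periodic : ∀ m j {A} → Inc A → length A ≡ m → Periodic A → length (enum m j A) ≡ #classes j m
enum-periodic m j i e per with periodic⇒ap per (inc⇒unique i)
... | a , p , k , 0<p , A≡ = trans (cong (length ∘ enum m j) (trans A≡ (cong (ap a p)
        (trans (sym (length-ap a p (2 + k))) (trans (cong length (sym A≡)) e))))) (enum-ap a p m j 0<p)

-- The set first becomes periodic after `k + 1` removals. Until then no removed element is an end of
-- a periodic set, so every removal is allowed and none is counted; afterwards a progression of m -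
-- k - 1 elements remains.
enum-nonperiodic : ∀ m j {A} → Inc A → length A ≡ m → 2 ≤ m → ¬ Periodic A →
  length (enum m j A) ≡ ∑< m (λ k → length (firsts (suc k) A) * #classes j (m ∸ suc k))
enum-nonperiodic (suc m) j {A} i e (s≤s 1≤m) ¬per = begin
  length (enum (suc m) j A)                                             ≡⟨ length-enum m j A ⟩
  ∑∈ (picks A) (length ∘ extend m j)                                    ≡⟨ ∑∈-cong (picks A) (λ p → each (picks⁻ A p)) ⟩
  ∑∈ (picks A) (λ (x , B) → ∑< (suc m) (λ k → #stop k B * #classes j (m ∸ k)))
    ≡⟨ ∑∈-∑-* (picks A) (suc m) (λ k (x , B) → #stop k B) (λ k → #classes j (m ∸ k)) ⟨
  ∑< (suc m) (λ k → ∑∈ (picks A) (λ (x , B) → #stop k B) * #classes j (m ∸ k))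
    ≡⟨ ∑-cong (suc m) (λ {k} _ → cong (_* #classes j (m ∸ k)) (length-firsts k A)) ⟨
  ∑< (suc m) (λ k → length (firsts (suc k) A) * #classes j (m ∸ k))     ∎
  where
  -- Two elements always form a periodic set, so `A` has at least three.
  2≤m : 2 ≤ m
  2≤m = ≤∧≢⇒< 1≤m λ { refl → ¬per (pair-periodic i e) }
  open ≡-Reasoning
  each : ∀ {x B} → Pick A x B → length (extend m j (x , B)) ≡ ∑< (suc m) (λ k → #stop k B * #classes j (m ∸ k))
  each {x} {B} p = trans (extend-keep m j {x} {B}
      (λ f → ¬per (subst Periodic (sym (pick-first i p f)) f)) (λ l → ¬per (subst Periodic (sym (pick-last i p l)) l)))
    (go (periodic? B))
    where
    go : Dec (Periodic B) → length (enum m j B) ≡ ∑< (suc m) (λ k → #stop k B * #classes j (m ∸ k))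
    go (yes perB) = trans (enum-periodic m j (pick-inc i p) (pick-length p e) perB) (sym (trans
      (cong₂ _+_ (trans (cong (_* #classes j m) (#stop-zero perB)) (*-identityˡ _))
                 (∑-zero m λ {k} _ → cong (_* #classes j (m ∸ suc k)) (#stop-suc k perB))) (+-identityʳ _)))
    go (no ¬perB) = trans (enum-nonperiodic m j (pick-inc i p) (pick-length p e) 2≤m ¬perB) (sym
      (cong₂ _+_ (cong (_* #classes j m) (#stop-no 0 ¬perB))
                 (∑-cong m λ {k} _ → cong (_* #classes j (m ∸ suc k)) (#stop-no (suc k) ¬perB))))

-- The removals lead down to a set of two elements. It is periodic, and a canonical order has to
-- remove its last element, which raises the exponent.
enum-exponent-0 : ∀ m {A t} → Inc A → length A ≡ 2 + m → t ∉ enum (2 + m) 0 A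
enum-exponent-0 m {A} i e t∈ with enum⁻ (suc m) 0 A t∈
enum-exponent-0 (suc m) i e t∈ | step p ¬f (keep ¬l) t∈′ = enum-exponent-0 m (pick-inc i p) (pick-length p e) t∈′
enum-exponent-0 zero {_ ∷ _ ∷ []} i e t∈ | step here ¬f (keep ¬l) _ = ¬f (pair-periodic i e)
enum-exponent-0 zero {_ ∷ _ ∷ []} i e t∈ | step (there here) ¬f (keep ¬l) _ = ¬l (pair-periodic i e)

-- Each removal raises the exponent by at most one, and the removal of the only remaining element
-- never does, so a nonempty set has exponents below its size.
enum-exponent-large : ∀ m j {A t} → length A ≡ m → m ≤ j → 0 < j → t ∉ enum m j A
enum-exponent-large zero (suc j) e l 0<j ()
enum-exponent-large (suc m) (suc j) {A} e l 0<j t∈ with enum⁻ m (suc j) A t∈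
... | step {B = B} p ¬f (keep ¬l) t∈′ = enum-exponent-large m (suc j) {B} (pick-length p e) (≤-trans (n≤1+n m) l) z<s t∈′
enum-exponent-large (suc (suc m)) (suc j) e (s≤s l) 0<j t∈ | step {B = B} p ¬f (flip _) t∈′ =
  enum-exponent-large (suc m) j {B} (pick-length p e) l (≤-trans z<s l) t∈′
enum-exponent-large (suc zero) (suc j) {_ ∷ []} e l 0<j t∈ | step here ¬f (flip (s≤s () , _)) t∈′

#classes-0 : ∀ n → 2 ≤ n → #classes 0 n ≡ 0
#classes-0 (suc (suc n)) _ = length-none (enum-exponent-0 n (⟦⟧-inc (2 + n)) (length-⟦⟧ (2 + n)))
#classes-0 (suc zero) (s≤s ())

#classes-large : ∀ j n → n ≤ j → 0 < j → #classes j n ≡ 0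
#classes-large j n l 0<j = length-none (enum-exponent-large n j (length-⟦⟧ n) l 0<j)

-- The recurrence for the lengths of the lists.

#firsts : ℕ → ℕ → ℕ
#firsts k n = length (firsts k ⟦ n ⟧)

periodic-tail : ∀ {x B} → 2 ≤ length B → Periodic (x ∷ B) → Periodic B
periodic-tail 2≤ (_ , p , l) = 2≤ , p , Linked.tail l

pick-∷ʳ⁺ : ∀ {A x B} z → Pick A x B → Pick (A ∷ʳ z) x (B ∷ʳ z)
pick-∷ʳ⁺ z here = here
pick-∷ʳ⁺ z (there p) = there (pick-∷ʳ⁺ z p)

-- A progression of 2 + m terms ≥ 1 ending in 3 + m has step 1 when m > 0, and
-- so omits only 1.
interior-nonperiodic : ∀ m {x B′} → 0 < m → Pick (ap 1 1 (3 + m)) x (B′ ∷ʳ ((2 + m) * 1 + 1)) →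
  ¬ Periodic (x ∷ B′ ∷ʳ ((2 + m) * 1 + 1)) → ¬ Periodic (B′ ∷ʳ ((2 + m) * 1 + 1))
interior-nonperiodic m {x} {B′} 0<m p ¬f per
  with periodic⇒ap per (inc⇒unique (pick-inc (ap-inc 1 1 (3 + m) z<s) p))
... | b , q , k , 0<q , B≡ = impossible b q 0<q B≡′
      (trans (sym (∷ʳ-injectiveʳ B′ (ap b q (suc m)) (trans B≡′ (ap-∷ʳ b q (suc m))))) z≡)
      (1≤all (subst (b ∈_) (sym B≡′) (here refl)))
  where
  A B : List ℕ
  A = ap 1 1 (3 + m)
  B = B′ ∷ʳ ((2 + m) * 1 + 1)
  z≡ : (2 + m) * 1 + 1 ≡ 3 + m
  z≡ = trans (cong (_+ 1) (*-identityʳ (2 + m))) (+-comm (2 + m) 1)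
  B≡′ : B ≡ ap b q (2 + m)
  B≡′ = trans B≡ (cong (ap b q) (trans (sym (length-ap b q (2 + k))) (trans (cong length (sym B≡))
          (pick-length p (length-ap 1 1 (3 + m))))))
  1≤all : ∀ {y} → y ∈ B → 1 ≤ y
  1≤all y∈ = All.lookup (ap-≥ 1 1 (3 + m)) (∈-resp-↭ (↭-sym (pick-↭ p)) (there y∈))
  impossible : ∀ b q → 0 < q → B ≡ ap b q (2 + m) → suc m * q + b ≡ 3 + m → ¬ 1 ≤ b
  impossible b 1 _ B≡ e _ with +-cancelˡ-≡ (suc m) b 2 (trans (cong (_+ b) (sym (*-identityʳ (suc m))))
                                  (trans e (+-comm 2 (suc m))))
  ... | refl = ¬f (subst Periodic (sym (cong₂ _∷_ x≡1 B≡)) (ap-periodic 1 1 (suc m)))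
    where
    x≡1 : x ≡ 1
    x≡1 = ∷-↭-unique {xs = B} (↭-trans (↭-sym (pick-↭ p)) (↭-reflexive (cong (1 ∷_) (sym B≡))))
            (unique-↭ (pick-↭ p) (inc⇒unique (ap-inc 1 1 (3 + m) z<s)))
  impossible b (suc (suc q)) _ _ e 1≤b = <⇒≱ (begin-strict
    3 + m                       <⟨ m<m+n (3 + m) 0<m ⟩
    3 + m + m                   ≡⟨ solve 1 (λ m → con 3 :+ m :+ m := (con 1 :+ m) :* con 2 :+ con 1) refl m ⟩
    suc m * 2 + 1               ≤⟨ +-mono-≤ (*-monoʳ-≤ (suc m) (s≤s (s≤s z≤n))) 1≤b ⟩
    suc m * suc (suc q) + b     ∎) (≤-reflexive e)
    where open ≤-Reasoning

module Recurrence (m j : ℕ) (0<m : 0 < m) where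

  private
    n = 3 + m
    A A′ : List ℕ
    A  = ap 1 1 n
    A′ = ap 1 1 (2 + m)
    z  = (2 + m) * 1 + 1

    incA : Inc A
    incA = ap-inc 1 1 n z<s

    A≡ : A ≡ A′ ∷ʳ z
    A≡ = ap-∷ʳ 1 1 (2 + m)

    -- The number of canonical orders beginning with `x` if `B` is not periodic, and 0 if it is, as
    -- for both ends of the progression. So it can be summed over all elements, which produces the
    -- numbers of words in `firsts`.
    later : ℕ × List ℕ → ℕ
    later (x , B) = ∑< (2 + m) (λ k → #stop (suc k) B * #classes (suc j) (2 + m ∸ suc k))

    later-periodic : ∀ {x B} → Periodic B → later (x , B) ≡ 0
    later-periodic per = ∑-zero (2 + m) λ {k} _ → cong (_* #classes (suc j) (2 + m ∸ suc k)) (#stop-suc k per)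

    last-pick : Pick A z A′
    last-pick = subst (λ C → Pick C z A′) (sym A≡) (pick-∷ʳ A′ z)

    extend-last : length (extend (2 + m) (suc j) (z , A′)) ≡ #classes j (2 + m)
    extend-last = trans (extend-flip (2 + m) j {z} {A′}
        (λ f → contradiction (∷-injectiveˡ (pick-first incA last-pick f)) λ ())
        (subst Periodic A≡ (ap-periodic 1 1 (suc m))))
      (enum-ap 1 1 (2 + m) j z<s)

    extend-other : ∀ {x B′} → Pick A′ x B′ →
                   length (extend (2 + m) (suc j) (x , B′ ∷ʳ z)) ≡ later (x , B′ ∷ʳ z)
    extend-other {x} {B′} p = go (periodic? (x ∷ B′ ∷ʳ z))
      where
      B = B′ ∷ʳ z
      pick : Pick A x B
      pick = subst (λ C → Pick C x B) (sym A≡) (pick-∷ʳ⁺ z p)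
      lenB : length B ≡ 2 + m
      lenB = pick-length pick (length-ap 1 1 n)
      go : Dec (Periodic (x ∷ B)) → _
      go (yes f) = trans (extend-first (2 + m) (suc j) {x} {B} f)
        (sym (later-periodic {x} (periodic-tail (subst (2 ≤_) (sym lenB) (s≤s (s≤s z≤n))) f)))
      go (no ¬f) = trans (extend-keep (2 + m) (suc j) {x} {B} ¬f ¬l)
        (trans (enum-nonperiodic (2 + m) (suc j) (pick-inc incA pick) lenB (s≤s (s≤s z≤n)) ¬per)
          (∑-cong (2 + m) λ {k} _ → cong (_* #classes (suc j) (2 + m ∸ suc k)) (sym (#stop-no (suc k) ¬per))))
        where
        ¬per : ¬ Periodic B
        ¬per = interior-nonperiodic m 0<m pick ¬f
        ¬l : ¬ Periodic (B ∷ʳ x)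
        ¬l l with ∷ʳ-injectiveʳ B A′ (trans (sym (pick-last incA pick l)) A≡)
        ... | refl = head∉tail (unique-↭ (pick-↭ last-pick) (inc⇒unique incA))
                       (∈-resp-↭ (↭-sym (pick-↭ p)) (here refl))

    others : List (ℕ × List ℕ)
    others = map (map₂ (_∷ʳ z)) (picks A′)

    picks≡ : picks A ≡ others ∷ʳ (z , A′)
    picks≡ = trans (cong picks A≡) (picks-∷ʳ A′ z)

    extend-others : ∑∈ others (length ∘ extend (2 + m) (suc j)) ≡ ∑∈ (picks A) later
    extend-others = trans (∑∈-cong others each) (sym (trans (cong (λ ps → ∑∈ ps later) picks≡)
      (trans (∑∈-∷ʳ others (z , A′) later)
      (trans (cong (∑∈ others later +_) (later-periodic {z} (ap-periodic 1 1 m))) (+-identityʳ _)))))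
      where
      each : ∀ {q} → q ∈ others → length (extend (2 + m) (suc j) q) ≡ later q
      each q∈ with ∈-map⁻ (map₂ (_∷ʳ z)) q∈
      ... | _ , p∈ , refl = extend-other (picks⁻ A′ p∈)

    laters : ∑∈ (picks A) later ≡ ∑< (2 + m) (λ k → #firsts (2 + k) n * #classes (suc j) (n ∸ (2 + k)))
    laters = sym (trans
      (∑-cong (2 + m) λ {k} _ → cong (_* #classes (suc j) (2 + m ∸ suc k))
        (trans (cong (length ∘ firsts (2 + k)) (⟦⟧≡ap n)) (length-firsts (suc k) A)))
      (∑∈-∑-* (picks A) (2 + m) (λ k (x , B) → #stop (suc k) B) (λ k → #classes (suc j) (2 + m ∸ suc k))))

  #classes-recurrence : #classes (suc j) n ≡ #classes j (2 + m) +
    ∑< (2 + m) (λ k → #firsts (2 + k) n * #classes (suc j) (n ∸ (2 + k)))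
  #classes-recurrence = begin
    #classes (suc j) n
      ≡⟨ trans (cong (length ∘ enum n (suc j)) (⟦⟧≡ap n)) (length-enum (2 + m) (suc j) A) ⟩
    ∑∈ (picks A) (length ∘ extend (2 + m) (suc j))
      ≡⟨ cong (λ ps → ∑∈ ps (length ∘ extend (2 + m) (suc j))) picks≡ ⟩
    ∑∈ (others ∷ʳ (z , A′)) (length ∘ extend (2 + m) (suc j))
      ≡⟨ ∑∈-∷ʳ others (z , A′) (length ∘ extend (2 + m) (suc j)) ⟩
    ∑∈ others (length ∘ extend (2 + m) (suc j)) + length (extend (2 + m) (suc j) (z , A′))
      ≡⟨ cong₂ _+_ (trans extend-others laters) extend-last ⟩
    _ + #classes j (2 + m)
      ≡⟨ +-comm _ (#classes j (2 + m)) ⟩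
    #classes j (2 + m) + ∑< (2 + m) (λ k → #firsts (2 + k) n * #classes (suc j) (n ∸ (2 + k))) ∎
    where open ≡-Reasoning

recurrence : ∀ n j → 4 ≤ n → 1 ≤ j → j ≤ n ∸ 1 →
  #classes j n ≡ #classes (j ∸ 1) (n ∸ 1) + sumFromTo 2 (n ∸ j ∸ 1) (λ k → #firsts k n * #classes j (n ∸ k))
recurrence n@(suc (suc (suc m))) (suc j) (s≤s (s≤s (s≤s 0<m))) _ _ =
  trans (Recurrence.#classes-recurrence m j 0<m) (cong (#classes j (2 + m) +_)
    -- Beyond the upper limit in the statement at most `suc j` elements remain, too few for the
    -- exponent `suc j`.
    (∑-truncate _ bound λ {k} l → trans (cong (#firsts (2 + k) n *_) (#classes-large (suc j) (n ∸ (2 + k)) (small k l) z<s))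
                                         (*-zeroʳ (#firsts (2 + k) n))))
  where
  bound : suc (n ∸ suc j ∸ 1) ∸ 2 ≤ 2 + m
  bound = ≤-trans (m∸n≤m (n ∸ suc j ∸ 1) 1) (≤-trans (m∸n≤m (n ∸ suc j) 1) (m∸n≤m (2 + m) j))
  small : ∀ k → suc (n ∸ suc j ∸ 1) ∸ 2 ≤ k → n ∸ (2 + k) ≤ suc j
  small k l = m≤n+o⇒m∸n≤o n (2 + k) (≤-trans (≤-trans (m≤n+m∸n n (suc j)) (+-monoʳ-≤ (suc j) (drop2 l))) (≤-reflexive (+-comm (suc j) (2 + k))))
    where
    drop2 : ∀ {a k} → suc (a ∸ 1) ∸ 2 ≤ k → a ≤ 2 + k
    drop2 {zero} l = z≤n
    drop2 {suc zero} l = s≤s z≤n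
    drop2 {suc (suc a)} l = s≤s (s≤s l)

-- Cardinalities from lists without repetitions.

module _ (S : Setoid 0ℓ 0ℓ) where
  open Setoid S using (Carrier; _≈_) renaming (refl to ≈-refl; sym to ≈-sym; trans to ≈-trans)

  enumerate⇒HasSize : ∀ {m} (e : Fin m → Carrier) → (∀ {i j} → e i ≈ e j → i ≡ j) →
                      (∀ x → ∃ λ i → x ≈ e i) → HasSize S m
  enumerate⇒HasSize e inj surj = record
    { to        = λ x → proj₁ (surj x)
    ; from      = e
    ; to-cong   = λ {x} {y} x≈y → inj (≈-trans (≈-sym (proj₂ (surj x))) (≈-trans x≈y (proj₂ (surj y))))
    ; from-cong = λ { refl → ≈-refl }
    ; inverse   = (λ {i} {x} x≈ → inj (≈-trans (≈-sym (proj₂ (surj x))) x≈)) ,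
                  (λ { {x} refl → ≈-sym (proj₂ (surj x)) })
    }

lookup-injective : {X : Set} {xs : List X} → Unique xs → ∀ {i j} → lookup xs i ≡ lookup xs j → i ≡ j
lookup-injective (_ ∷ _) {Fin.zero} {Fin.zero} _ = refl
lookup-injective (px ∷ _) {Fin.zero} {Fin.suc j} e = contradiction e (All.lookup px (∈-lookup j))
lookup-injective (px ∷ _) {Fin.suc i} {Fin.zero} e = contradiction (sym e) (All.lookup px (∈-lookup i))
lookup-injective (_ ∷ u) {Fin.suc i} {Fin.suc j} e = cong Fin.suc (lookup-injective u e)

list⇒HasSize : {P : Pred Word 0ℓ} {ws : List (List ℕ)} (f : List ℕ → Word) → Unique ws →
  (∀ {w} → w ∈ ws → P (f w)) → (∀ {w w′} → w ∈ ws → w′ ∈ ws → f w ≡ f w′ → w ≡ w′) →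
  (∀ {u} → P u → ∃ λ w → w ∈ ws × u ≡ f w) → HasSize ⟪ P ⟫ (length ws)
list⇒HasSize {P} {ws} f unique sound inj complete = enumerate⇒HasSize ⟪ P ⟫
  (λ i → f (lookup ws i) , sound (∈-lookup i))
  (λ {i} {j} e → lookup-injective unique (inj (∈-lookup i) (∈-lookup j) e))
  (λ (u , Pu) → let w , w∈ , u≡ = complete Pu in index w∈ , trans u≡ (cong f (lookup-index w∈)))

-- The size of 𝒟

infixl 6 _∖_
-- Applied to `⟦ n ⟧`, this is the complement in the definition of `𝒟`; with a general list,
-- elements can be removed one at a time.
_∖_ : List ℕ → List ℕ → List ℕ
A ∖ xs = filter (λ x → x ∉? xs) A

∖-[] : ∀ A → A ∖ [] ≡ A
∖-[] A = filter-all (λ x → x ∉? []) (All.tabulate λ _ ())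

∖-∷-cong : ∀ {a x} A B w → a ≢ x → A ∖ (x ∷ w) ≡ B ∖ w → (a ∷ A) ∖ (x ∷ w) ≡ (a ∷ B) ∖ w
∖-∷-cong {a} {x} A B w a≢x e = go (a ∈? w)
  where
  go : Dec (a ∈ w) → (a ∷ A) ∖ (x ∷ w) ≡ (a ∷ B) ∖ w
  go (yes a∈) = trans (filter-reject (λ y → y ∉? (x ∷ w)) (λ ∉ → ∉ (there a∈)))
                 (trans e (sym (filter-reject (λ y → y ∉? w) (λ ∉ → ∉ a∈))))
  go (no a∉) = trans (filter-accept (λ y → y ∉? (x ∷ w)) λ { (here e) → a≢x e ; (there a∈) → a∉ a∈ })
                 (trans (cong (a ∷_) e) (sym (filter-accept (λ y → y ∉? w) a∉)))

∖-absent : ∀ {x} B w → x ∉ B → B ∖ (x ∷ w) ≡ B ∖ w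
∖-absent [] w x∉ = refl
∖-absent (b ∷ B) w x∉ = ∖-∷-cong B B w (λ e → x∉ (here (sym e))) (∖-absent B w (x∉ ∘ there))

∖-pick : ∀ {A x B} w → Unique A → Pick A x B → A ∖ (x ∷ w) ≡ B ∖ w
∖-pick {x ∷ B} w u here = trans (filter-reject (λ y → y ∉? (x ∷ w)) (λ ∉ → ∉ (here refl)))
                                (∖-absent B w (head∉tail u))
∖-pick {a ∷ A} {x} {_ ∷ B} w u@(_ ∷ u′) (there p) = ∖-∷-cong A B w
  (λ { refl → head∉tail u (∈-resp-↭ (↭-sym (pick-↭ p)) (here refl)) }) (∖-pick w u′ p)

-- `𝒟` with any `A` in place of `⟦ n ⟧`, so that an induction can pass to what the first letter
-- leaves of `A`.
record First (k : ℕ) (A w : List ℕ) : Set where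
  field
    has-length   : length w ≡ k
    distinct     : Unique w
    inside       : w ⊆ A
    periodic     : Periodic (A ∖ w)
    not-periodic : ∀ j → 1 ≤ j → j < k → ¬ Periodic (A ∖ take j w)

pick-∉ : ∀ {A x B} → Unique A → Pick A x B → x ∉ B
pick-∉ u p = head∉tail (unique-↭ (pick-↭ p) u)

first-[] : ∀ {A x B} → Unique A → Pick A x B → Periodic B → First 1 A (x ∷ [])
first-[] {A} {x} {B} u p per = record
  { has-length   = refl
  ; distinct     = [] ∷ []
  ; inside       = λ { (here refl) → ∈-resp-↭ (↭-sym (pick-↭ p)) (here refl) }
  ; periodic     = subst Periodic (sym (trans (∖-pick [] u p) (∖-[] B))) per
  ; not-periodic = λ { (suc _) _ (s≤s ()) }
  }

first-∷ : ∀ {k A x B w} → Unique A → Pick A x B → ¬ Periodic B → First k B w → First (suc k) A (x ∷ w)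
first-∷ {k} {A} {x} {B} {w} u p ¬per F = record
  { has-length   = cong suc F.has-length
  ; distinct     = All.tabulate (λ { y∈ refl → pick-∉ u p (F.inside y∈) }) ∷ F.distinct
  ; inside       = λ { (here refl) → ∈-resp-↭ (↭-sym (pick-↭ p)) (here refl)
                     ; (there y∈) → ∈-resp-↭ (↭-sym (pick-↭ p)) (there (F.inside y∈)) }
  ; periodic     = subst Periodic (sym (∖-pick w u p)) F.periodic
  ; not-periodic = λ { (suc j) _ (s≤s l) per → not-periodic′ j l (subst Periodic (∖-pick (take j w) u p) per) }
  }
  where
  module F = First F
  not-periodic′ : ∀ j → j < k → ¬ Periodic (B ∖ take j w)
  -- The empty prefix of `w` corresponds to the prefix of `x ∷ w` consisting of `x` alone, with
  -- complement `B`.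
  not-periodic′ zero _ per = ¬per (subst Periodic (∖-[] B) per)
  not-periodic′ (suc j) l per = F.not-periodic (suc j) (s≤s z≤n) l per

first-tail : ∀ {k A x B w} → Unique A → Pick A x B → First (suc (suc k)) A (x ∷ w) → First (suc k) B w
first-tail {k} {A} {x} {B} {w} u p F = record
  { has-length   = suc-injective F.has-length
  ; distinct     = AllPairs.tail F.distinct
  ; inside       = λ y∈ → strip y∈ (∈-resp-↭ (pick-↭ p) (F.inside (there y∈)))
  ; periodic     = subst Periodic (∖-pick w u p) F.periodic
  ; not-periodic = λ j 1≤j l per → F.not-periodic (suc j) (s≤s z≤n) (s≤s l)
                     (subst Periodic (sym (∖-pick (take j w) u p)) per)
  }
  where
  module F = First F
  strip : ∀ {y} → y ∈ w → y ∈ x ∷ B → y ∈ B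
  strip y∈ (here refl) = contradiction y∈ (head∉tail F.distinct)
  strip y∈ (there y∈′) = y∈′

stop⁻ : ∀ {P : Set} (P? : Dec P) k {ws w} → w ∈ stop P? k ws → (P × k ≡ 0 × w ≡ []) ⊎ (¬ P × w ∈ ws)
stop⁻ (yes p) zero (here refl) = inj₁ (p , refl , refl)
stop⁻ (no ¬p) k w∈ = inj₂ (¬p , w∈)

stop⁺-[] : ∀ {P : Set} (P? : Dec P) {ws} → P → [] ∈ stop P? 0 ws
stop⁺-[] (yes _) p = here refl
stop⁺-[] (no ¬p) p = contradiction p ¬p

stop⁺ : ∀ {P : Set} (P? : Dec P) k {ws w} → ¬ P → w ∈ ws → w ∈ stop P? k ws
stop⁺ (yes p) k ¬p w∈ = contradiction p ¬p
stop⁺ (no _) k ¬p w∈ = w∈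

firsts⁻ : ∀ k {A w} → Inc A → w ∈ firsts k A → First k A w
firsts⁻ (suc k) {A} i w∈ with find (∈-concatMap⁻ (first-step k) {xs = picks A} w∈)
... | (x , B) , p∈ , w∈′ with ∈-map⁻ _ w∈′
...   | w , w∈″ , refl with stop⁻ (periodic? B) k w∈″
...     | inj₁ (per , refl , refl) = first-[] (inc⇒unique i) (picks⁻ A p∈) per
...     | inj₂ (¬per , w∈‴) = first-∷ (inc⇒unique i) (picks⁻ A p∈) ¬per (firsts⁻ k (pick-inc i (picks⁻ A p∈)) w∈‴)

firsts⁺ : ∀ k {A w} → Inc A → First (suc k) A w → w ∈ firsts (suc k) A
firsts⁺ k {w = []} i F = contradiction (First.has-length F) λ ()
firsts⁺ k {A} {x ∷ w} i F with ∈⇒pick (First.inside F (here refl))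
... | B , p = ∈-concatMap⁺ (first-step k) {xs = picks A} (lose (picks⁺ p) (∈-map⁺ (x ∷_) (rest k w F)))
  where
  rest : ∀ k w → First (suc k) A (x ∷ w) → w ∈ stop (periodic? B) k (firsts k B)
  rest zero [] F = stop⁺-[] (periodic? B)
    (subst Periodic (trans (∖-pick [] (inc⇒unique i) p) (∖-[] B)) (First.periodic F))
  rest zero (_ ∷ _) F = contradiction (First.has-length F) λ ()
  rest (suc k) w F = stop⁺ (periodic? B) (suc k)
    (λ per → First.not-periodic F 1 (s≤s z≤n) (s≤s (s≤s z≤n))
      (subst Periodic (sym (trans (∖-pick [] (inc⇒unique i) p) (∖-[] B))) per))
    (firsts⁺ k (pick-inc i p) (first-tail (inc⇒unique i) p F))

stop-unique : ∀ {P : Set} (P? : Dec P) k {ws} → Unique ws → Unique (stop P? k ws)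
stop-unique (yes _) zero u = [] ∷ []
stop-unique (yes _) (suc k) u = []
stop-unique (no _) k u = u

firsts-unique : ∀ k {A} → Inc A → Unique (firsts k A)
firsts-unique zero i = []
firsts-unique (suc k) {A} i = unique-concatMap-picks (first-step k) A (inc⇒unique i)
  (λ {x} {B} p → Unique.map⁺ ∷-injectiveʳ (stop-unique (periodic? B) k (firsts-unique k (pick-inc i p))))
  (λ w∈ → let (w , _ , e) = ∈-map⁻ _ w∈ in w , e)

toWord : List ℕ → Word
toWord = map (mk ∘ pred)

letters-toWord : ∀ {w} → All (1 ≤_) w → letters (toWord w) ≡ w
letters-toWord [] = refl
letters-toWord (s≤s _ ∷ ps) = cong (_ ∷_) (letters-toWord ps)

letters-positive : ∀ u → All (1 ≤_) (letters u)
letters-positive [] = []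
letters-positive ((suc _ , _) ∷ u) = s≤s z≤n ∷ letters-positive u

𝒟-size : ∀ k n → 1 ≤ k → HasSize ⟪ 𝒟 k n ⟫ (#firsts k n)
𝒟-size (suc k) n _ = list⇒HasSize toWord (firsts-unique (suc k) (⟦⟧-inc n)) sound
  (λ w∈ w′∈ e → trans (sym (letters≡ w∈)) (trans (cong letters e) (letters≡ w′∈))) complete
  where
  letters≡ : ∀ {w} → w ∈ firsts (suc k) ⟦ n ⟧ → letters (toWord w) ≡ w
  letters≡ w∈ = letters-toWord (All.tabulate λ p∈ →
    Inside.1≤ n (First.inside (firsts⁻ (suc k) (⟦⟧-inc n) w∈) p∈))
  sound : ∀ {w} → w ∈ firsts (suc k) ⟦ n ⟧ → 𝒟 (suc k) n (toWord w)
  sound {w} w∈ = record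
    { length-i     = trans (length-map _ w) F.has-length
    ; distinct     = subst Unique (sym (letters≡ w∈)) F.distinct
    ; in-[n]       = subst (_⊆ ⟦ n ⟧) (sym (letters≡ w∈)) F.inside
    ; periodic     = subst (λ l → Periodic (⟦ n ⟧∖ l)) (sym (letters≡ w∈)) F.periodic
    ; not-periodic = λ j 1≤j j<k → subst (λ l → ¬ Periodic (⟦ n ⟧∖ take j l)) (sym (letters≡ w∈)) (F.not-periodic j 1≤j j<k)
    }
    where module F = First (firsts⁻ (suc k) (⟦⟧-inc n) w∈)
  complete : ∀ {u} → 𝒟 (suc k) n u → ∃ λ w → w ∈ firsts (suc k) ⟦ n ⟧ × u ≡ toWord w
  complete {u} d = letters u , firsts⁺ k (⟦⟧-inc n) (record
    { has-length = trans (length-letters u) D.length-i ; distinct = D.distinct ; inside = D.in-[n]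
    ; periodic = D.periodic ; not-periodic = D.not-periodic }) ,
    letters-injective (sym (letters-toWord (letters-positive u)))
    where module D = 𝒟 d

-- The sizes and the number of the classes

class-size : ∀ {n s} → s ↭ ⟦ n ⟧ → (L : ClassList n ⟦ n ⟧ s) →
             HasSize ⟪ class n (word n s) ⟫ (2 ^ ClassList.exponent L)
class-size {n} {s} s↭ L = subst (HasSize ⟪ class n (word n s) ⟫) size (list⇒HasSize (word n) unique
  (λ r∈ → let r↭ , sim = sound r∈ in word-𝒮 r↭ , sim⇒∼ss s↭ r↭ sim)
  (λ r∈ r′∈ → word-injective (proj₁ (sound r∈)) (proj₁ (sound r′∈)))
  (λ {v} (v∈ , eq) → inv n (letters v) ,
     complete (inv-↭ v∈) (Inside.∼ss⇒sim n s↭ (inv-↭ v∈) (subst (word n s ∼ss_) (sym (word-inv v∈)) eq)) ,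
     sym (word-inv v∈)))
  where open ClassList L

⟦⟧-class-list : ∀ {n s} → s ↭ ⟦ n ⟧ → ClassList n ⟦ n ⟧ s
⟦⟧-class-list {n} = class-list n (⟦⟧-inc n) (length-⟦⟧ n)

classes-size : ∀ j n → HasSize (classes j n) (#classes j n)
classes-size j n = enumerate⇒HasSize (classes j n) element
  (λ {i} {k} eq → lookup-injective (enum-unique n j (⟦⟧-inc n)) (proj₁ (enum-sim n j j (⟦⟧-inc n) (length-⟦⟧ n)
    (∈-lookup i) (∈-lookup k) (Inside.∼ss⇒sim n (perm (∈-lookup i)) (perm (∈-lookup k)) eq))))
  surjective
  where
  perm : ∀ {t} → t ∈ enum n j ⟦ n ⟧ → t ↭ ⟦ n ⟧
  perm = enum-↭ n j (length-⟦⟧ n)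
  exponent≡ : ∀ {t} (t∈ : t ∈ enum n j ⟦ n ⟧) → ClassList.exponent (⟦⟧-class-list (perm t∈)) ≡ j
  -- `t` is canonical and similar to the canonical representative of its own class, so `enum-sim`
  -- equates their exponents.
  exponent≡ t∈ = sym (proj₂ (enum-sim n j exponent (⟦⟧-inc n) (length-⟦⟧ n) t∈ canonical similar))
    where open ClassList (⟦⟧-class-list (perm t∈))
  element : Fin (#classes j n) → Setoid.Carrier (classes j n)
  element i = word n t , word-𝒮 (perm t∈) ,
    subst (λ e → HasSize ⟪ class n (word n t) ⟫ (2 ^ e)) (exponent≡ t∈) (class-size (perm t∈) (⟦⟧-class-list (perm t∈)))
    where
    t = lookup (enum n j ⟦ n ⟧) i
    t∈ = ∈-lookup {xs = enum n j ⟦ n ⟧} i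
  surjective : ∀ x → ∃ λ i → proj₁ x ∼ss proj₁ (element i)
  surjective (u , u∈ , size) = index t∈ , subst (_∼ss word n (lookup (enum n j ⟦ n ⟧) (index t∈))) (word-inv u∈)
    (subst (λ t → word n s ∼ss word n t) (lookup-index t∈) (sim⇒∼ss s↭ (perm t∈) similar))
    where
    s = inv n (letters u)
    s↭ : s ↭ ⟦ n ⟧
    s↭ = inv-↭ u∈
    L = ⟦⟧-class-list s↭
    open ClassList L using (exponent; representative; canonical; similar)
    exponent≡j : exponent ≡ j
    exponent≡j = 2^-injective (HasSize-unique (subst (λ v → HasSize ⟪ class n v ⟫ (2 ^ exponent)) (word-inv u∈) (class-size s↭ L)) size)
      where
      2^-injective : ∀ {a b} → 2 ^ a ≡ 2 ^ b → a ≡ b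
      2^-injective {a} {b} e with <-cmp a b
      ... | tri≈ _ e′ _ = e′
      ... | tri< l _ _ = contradiction e (<⇒≢ (^-monoʳ-< 2 (s≤s (s≤s z≤n)) l))
      ... | tri> _ _ l = contradiction e (>⇒≢ (^-monoʳ-< 2 (s≤s (s≤s z≤n)) l))
    t∈ : representative ∈ enum n j ⟦ n ⟧
    t∈ = subst (λ e → representative ∈ enum n e ⟦ n ⟧) exponent≡j canonical

mainTheorem8 : ∃₂ λ (s d : ℕ → ℕ → ℕ) →
    (∀ j n → 2 ≤ n → HasSize (classes j n) (s j n))
    × (∀ k n → 3 ≤ n → 1 ≤ k → k ≤ n ∸ 2 → HasSize ⟪ 𝒟 k n ⟫ (d k n))
    × (∀ n → 2 ≤ n → s 0 n ≡ 0)
    × s 1 2 ≡ 1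
    × s 1 3 ≡ 1
    × s 2 3 ≡ 1
    × (∀ n j → 4 ≤ n → 1 ≤ j → j ≤ n ∸ 1 →
    s j n ≡ s (j ∸ 1) (n ∸ 1) + sumFromTo 2 (n ∸ j ∸ 1) (λ k → d k n * s j (n ∸ k)))
mainTheorem8 = #classes , #firsts , (λ j n _ → classes-size j n) , (λ k n _ 1≤k _ → 𝒟-size k n 1≤k) ,
  -- The three small values are found by evaluating `enum`.
  #classes-0 , refl , refl , refl , recurrence
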